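{- Let $n \geq 5$ and let $T \subseteq S_n$ be a set of transpositions that generates $S_n$. Suppose that the transposition graph $G(T)$ is not isomorphic to the complete graph $K_n$. Then $\operatorname{Aut}(\operatorname{Cay}(S_n,T)) = R(S_n) \rtimes \operatorname{Aut}(S_n,T)$ (internal semidirect product of subgroups, with $R(S_n)$ the normal factor), implying that $\operatorname{Cay}(S_n,T)$ is normal.
   Context: $S_n$ is the symmetric group on $[n]=\{1,\dots,n\}$, and a transposition is a permutation $(i\,j)$ with $i\neq j$. The transposition graph $G(T)$ is the simple graph with vertex set $[n]$ and edge set $E(T)=\{\{i,j\} : (i\,j)\in T\}$. For a finite group $H$ and a generating subset $T\subseteq H$ with $T=T^{ -1}$ and $\mathrm{id}\notin T$, the Cayley graph $\operatorname{Cay}(H,T)$ is the simple undirected graph with vertex set $H$ and edge set $\{\{a,ta\} : a\in H,\ t\in T\}$. $\operatorname{Aut}(\operatorname{Cay}(H,T))$ is its group of graph automorphisms. The right regular representation is $R(H)=\{\rho_a : a\in H\}$, where $\rho_a$ is the map $b\mapsto ba$ on $H$; it is a subgroup of $\operatorname{Aut}(\operatorname{Cay}(H,T))$. $\operatorname{Aut}(H)$ is the group of group automorphisms of $H$ and $\operatorname{Aut}(H,T)=\{f\in\operatorname{Aut}(H) : f(T)=T\}$, which is also a subgroup of $\operatorname{Aut}(\operatorname{Cay}(H,T))$. The Cayley graph $\operatorname{Cay}(H,T)$ is called normal if $R(H)$ is a normal subgroup of $\operatorname{Aut}(\operatorname{Cay}(H,T))$. -}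

module Defs where

open import Algebra.Bundles using (Group)
import Algebra.Morphism.Structures as Morphism
import Algebra.Properties.Group as GroupProperties
open import Data.Fin.Base using (Fin)
open import Data.Fin.Permutation using (Permutation′; transpose)
import Data.Fin.Permutation.Components as PC
open import Data.Fin.Properties using (_≟_)
open import Data.Nat.Base using (ℕ)
open import Data.Product.Base using (∃; ∃₂; _×_; _,_; proj₁; proj₂)
open import Function.Base using (_∘_)
open import Function.Bundles using (Inverse; _⇔_)
import Function.Construct.Composition as Composition
import Function.Construct.Identity as Identity
import Function.Construct.Symmetry as Symmetry
open import Level using (Level; _⊔_; suc; 0ℓ)
open import Relation.Binary.Bundles using (Setoid)
open import Relation.Binary.Core using (Rel)
open import Relation.Binary.Definitions using (Symmetric; Irreflexive; _Respects_; _Respects₂_)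
open import Relation.Binary.PropositionalEquality.Core
  using (_≡_; _≢_; refl; sym; trans; cong; subst; ≢-sym)
import Relation.Binary.PropositionalEquality.Properties as ≡
open import Relation.Nullary.Decidable.Core using (yes; no)
open import Relation.Nullary.Negation.Core using (¬_; contradiction)
open import Relation.Unary using (Pred; _∈_; _∉_; _⊆_; _≐_)

private
  variable
    c ℓ ℓ₁ ℓ₂ p q r : Level

module _ (G : Group c ℓ) where
  open Group G

  record IsSubgroup (P : Pred Carrier p) : Set (c ⊔ ℓ ⊔ p) where
    field
      respects  : P Respects _≈_
      ε-closed  : ε ∈ P
      ∙-closed  : ∀ {x y} → x ∈ P → y ∈ P → x ∙ y ∈ P
      ⁻¹-closed : ∀ {x} → x ∈ P → x ⁻¹ ∈ P

  record IsNormalSubgroupOf (N : Pred Carrier p) (A : Pred Carrier q) : Set (c ⊔ ℓ ⊔ p ⊔ q) where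
    field
      subgroup    : IsSubgroup N
      ambient     : IsSubgroup A
      contained   : N ⊆ A
      conj-closed : ∀ {a x} → a ∈ A → x ∈ N → (a ∙ x) ∙ a ⁻¹ ∈ N

  record IsInternalSemidirectProduct
    (A : Pred Carrier p) (N : Pred Carrier q) (K : Pred Carrier r) : Set (c ⊔ ℓ ⊔ p ⊔ q ⊔ r) where
    field
      N-normal    : IsNormalSubgroupOf N A
      K-subgroup  : IsSubgroup K
      K-contained : K ⊆ A
      trivial-∩   : ∀ {x} → x ∈ N → x ∈ K → x ≈ ε
      factorise   : ∀ {x} → x ∈ A → ∃₂ λ y z → y ∈ N × z ∈ K × x ≈ y ∙ z

  data ⟨_⟩ (T : Pred Carrier p) : Pred Carrier (c ⊔ ℓ ⊔ p) where
    gen  : ∀ {x} → x ∈ T → x ∈ ⟨ T ⟩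
    unit : ε ∈ ⟨ T ⟩
    mul  : ∀ {x y} → x ∈ ⟨ T ⟩ → y ∈ ⟨ T ⟩ → x ∙ y ∈ ⟨ T ⟩
    inv  : ∀ {x} → x ∈ ⟨ T ⟩ → x ⁻¹ ∈ ⟨ T ⟩
    resp : ∀ {x y} → x ≈ y → x ∈ ⟨ T ⟩ → y ∈ ⟨ T ⟩

  Generates : Pred Carrier p → Set (c ⊔ ℓ ⊔ p)
  Generates T = ∀ x → x ∈ ⟨ T ⟩

-- Automorphism groups and their subgroups are predicates on a group Sym S
-- of setoid bijections.  Composition is that of functions: (σ ∙ τ) x = σ (τ x).

Sym : Setoid c ℓ → Group (c ⊔ ℓ) (c ⊔ ℓ)
Sym S = record
  { Carrier = Inverse S S
  ; _≈_     = λ σ τ → ∀ x → to σ x ≈ to τ x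
  ; _∙_     = λ σ τ → Composition.inverse τ σ
  ; ε       = Identity.inverse S
  ; _⁻¹     = Symmetry.inverse
  ; isGroup = record
    { isMonoid = record
      { isSemigroup = record
        { isMagma = record
          { isEquivalence = record
            { refl  = λ _ → ≈-refl
            ; sym   = λ σ≈τ x → ≈-sym (σ≈τ x)
            ; trans = λ σ≈τ τ≈υ x → ≈-trans (σ≈τ x) (τ≈υ x)
            }
          ; ∙-cong = λ {σ} {σ′} {τ} {τ′} σ≈σ′ τ≈τ′ x →
              ≈-trans (to-cong σ (τ≈τ′ x)) (σ≈σ′ (to τ′ x))
          }
        ; assoc = λ _ _ _ _ → ≈-refl
        }
      ; identity = (λ _ _ → ≈-refl) , (λ _ _ → ≈-refl)
      }
    ; inverse = (λ σ x → strictlyInverseʳ σ x) , (λ σ x → strictlyInverseˡ σ x)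
    ; ⁻¹-cong = λ {σ} {τ} σ≈τ x → ≈-trans
        (from-cong σ (≈-trans (≈-sym (strictlyInverseˡ τ x)) (≈-sym (σ≈τ (from τ x)))))
        (strictlyInverseʳ σ (from τ x))
    }
  }
  where
  open Setoid S using (_≈_) renaming (refl to ≈-refl; sym to ≈-sym; trans to ≈-trans)
  open Inverse

-- The carrier unfolds to Permutation′ n and the equality to
-- Data.Fin.Permutation._≈_.

SymmetricGroup : ℕ → Group 0ℓ 0ℓ
SymmetricGroup n = Sym (≡.setoid (Fin n))

record SimpleGraph c ℓ p : Set (suc (c ⊔ ℓ ⊔ p)) where
  infix 4 _~_
  field
    vertices : Setoid c ℓ
  open Setoid vertices public using (_≈_) renaming (Carrier to Vertex)
  field
    _~_      : Rel Vertex p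
    respects : _~_ Respects₂ _≈_
    ~-sym    : Symmetric _~_
    ~-irrefl : Irreflexive _≈_ _~_

open SimpleGraph using (vertices; Vertex)

IsGraphIsomorphism : (G : SimpleGraph c ℓ p) (H : SimpleGraph ℓ₁ ℓ₂ q) →
                     Pred (Inverse (vertices G) (vertices H)) (c ⊔ p ⊔ q)
IsGraphIsomorphism G H φ = ∀ u v → u G.~ v ⇔ to φ u H.~ to φ v
  where
  module G = SimpleGraph G
  module H = SimpleGraph H
  open Inverse

infix 4 _≅_

_≅_ : SimpleGraph c ℓ p → SimpleGraph ℓ₁ ℓ₂ q → Set (c ⊔ ℓ ⊔ p ⊔ ℓ₁ ⊔ ℓ₂ ⊔ q)
G ≅ H = ∃ (IsGraphIsomorphism G H)

AutGraph : (G : SimpleGraph c ℓ p) → Pred (Inverse (vertices G) (vertices G)) (c ⊔ p)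
AutGraph G = IsGraphIsomorphism G G

completeGraph : ℕ → SimpleGraph 0ℓ 0ℓ 0ℓ
completeGraph n = record
  { vertices = ≡.setoid (Fin n)
  ; _~_      = _≢_
  ; respects = (λ { refl i≢j → i≢j }) , (λ { refl i≢j → i≢j })
  ; ~-sym    = ≢-sym
  ; ~-irrefl = λ i≡j i≢j → i≢j i≡j
  }

module _ (H : Group c ℓ) where
  open Group H hiding (refl; sym; trans)
  private
    module H = Group H

  record IsConnectionSet (T : Pred Carrier p) : Set (c ⊔ ℓ ⊔ p) where
    field
      respects  : T Respects _≈_
      symmetric : ∀ {t} → t ∈ T → t ⁻¹ ∈ T
      ε∉T       : ε ∉ T
      generates : Generates H T

  -- Since T = T⁻¹, {a , b} is of the form {x , t x} with t ∈ T if and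
  -- only if b = t a for some t ∈ T.

  Cay : (T : Pred Carrier p) → IsConnectionSet T → SimpleGraph c ℓ (c ⊔ ℓ ⊔ p)
  Cay T isConn = record
    { vertices = setoid
    ; _~_      = λ a b → ∃ λ t → t ∈ T × b ≈ t ∙ a
    ; respects =
        (λ b≈b′ (t , t∈T , b≈ta) → t , t∈T , H.trans (H.sym b≈b′) b≈ta)
      , (λ a≈a′ (t , t∈T , b≈ta) → t , t∈T , H.trans b≈ta (∙-congˡ a≈a′))
    ; ~-sym    = λ {a} {b} (t , t∈T , b≈ta) → t ⁻¹ , symmetric t∈T ,
        H.sym (H.trans (∙-congˡ b≈ta) (\\-leftDividesʳ t a))
    ; ~-irrefl = λ {a} {b} a≈b (t , t∈T , b≈ta) → ε∉T
        (respects (identityˡ-unique t a (H.sym (H.trans a≈b b≈ta))) t∈T)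
    }
    where
    open IsConnectionSet isConn
    open GroupProperties H

  -- R(H), Aut(H) and, with T stabilised setwise, Aut(H,T), as subsets of
  -- Sym setoid.

  RightRegular : Pred (Inverse setoid setoid) (c ⊔ ℓ)
  RightRegular φ = ∃ λ a → ∀ b → to φ b ≈ b ∙ a
    where open Inverse

  AutGroup : Pred (Inverse setoid setoid) (c ⊔ ℓ)
  AutGroup φ = IsGroupIsomorphism (to φ)
    where
    open Inverse
    open Morphism.GroupMorphisms rawGroup rawGroup

  image : Inverse setoid setoid → Pred Carrier p → Pred Carrier (c ⊔ ℓ ⊔ p)
  image φ T y = ∃ λ x → x ∈ T × y ≈ to φ x
    where open Inverse

  AutGroupStabilising : Pred Carrier p → Pred (Inverse setoid setoid) (c ⊔ ℓ ⊔ p)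
  AutGroupStabilising T φ = φ ∈ AutGroup × image φ T ≐ T

  IsNormalCayley : (T : Pred Carrier p) → IsConnectionSet T → Set (c ⊔ ℓ ⊔ p)
  IsNormalCayley T isConn =
    IsNormalSubgroupOf (Sym setoid) RightRegular (AutGraph (Cay T isConn))

module _ {n : ℕ} where
  open Group (SymmetricGroup n) using (_≈_; _⁻¹; ε)

  IsTransposition : Pred (Permutation′ n) 0ℓ
  IsTransposition t = ∃₂ λ i j → i ≢ j × t ≈ transpose i j

  record IsTranspositionSet (T : Pred (Permutation′ n) p) : Set p where
    field
      respects       : T Respects _≈_
      transpositions : T ⊆ IsTransposition

  transpose-comm : ∀ (i j : Fin n) → transpose i j ≈ transpose j i
  transpose-comm i j k with k ≟ i in k≟i | k ≟ j in k≟j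
  ... | yes k≡i | yes k≡j = trans (sym k≡j) k≡i
  ... | yes _   | no  _   rewrite k≟i | k≟j = refl
  ... | no  _   | yes _   rewrite k≟i | k≟j = refl
  ... | no  _   | no  _   rewrite k≟i | k≟j = refl

  transpose-moves : ∀ (i j : Fin n) → PC.transpose i j i ≡ j
  transpose-moves i j with i ≟ i
  ... | yes _   = refl
  ... | no  i≢i = contradiction refl i≢i

  transpositionGraph : (T : Pred (Permutation′ n) p) → IsTranspositionSet T → SimpleGraph 0ℓ 0ℓ p
  transpositionGraph T isTr = record
    { vertices = ≡.setoid (Fin n)
    ; _~_      = λ i j → i ≢ j × transpose i j ∈ T
    ; respects = (λ { refl i~j → i~j }) , (λ { refl i~j → i~j })
    ; ~-sym    = λ {i} {j} (i≢j , ij∈T) → ≢-sym i≢j , respects (transpose-comm i j) ij∈T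
    ; ~-irrefl = λ i≡j (i≢j , _) → i≢j i≡j
    }
    where open IsTranspositionSet isTr

  transpositionConnectionSet : (T : Pred (Permutation′ n) p) → IsTranspositionSet T →
    Generates (SymmetricGroup n) T → IsConnectionSet (SymmetricGroup n) T
  transpositionConnectionSet T isTr T-generates = record
    { respects  = respects
    ; symmetric = λ {t} t∈T → respects (self-inverse {t} (transpositions t∈T)) t∈T
    ; ε∉T       = λ ε∈T → ε-not-transposition (transpositions ε∈T)
    ; generates = T-generates
    }
    where
    open IsTranspositionSet isTr
    self-inverse : ∀ {t} → t ∈ IsTransposition → t ≈ t ⁻¹
    self-inverse {t} (i , j , _ , t≈ij) = λ k →
      trans (t≈ij k) (trans (transpose-comm i j k)
        (Group.⁻¹-cong (SymmetricGroup n) {transpose i j} {t} (λ x → sym (t≈ij x)) k))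
    ε-not-transposition : ¬ ε ∈ IsTransposition
    ε-not-transposition (i , j , i≢j , ε≈ij) = i≢j (trans (ε≈ij i) (transpose-moves i j))

{-# OPTIONS --safe #-}

-- It suffices that an automorphism φ of Cay(Sₙ,T) with φ(id) = id is a
-- homomorphism, which by connectivity reduces to φ(ts) = φ(t) φ(s) for s, t ∈ T.
-- Counting common neighbours shows that φ permutes T preserving disjointness and
-- triangles of G(T).  If s, t are disjoint, the equation holds because ts is the
-- only common neighbour of s and t besides id.  If they meet, suppose that it
-- fails.  When φ(s), φ(t) span no triangle, preservation of disjointness forces the
-- free end k of one of these edges to have degree at most 2, and evaluating
-- φ(sts) = φ(tst) at k is contradictory unless both edges lie on a 4-cycle, where an
-- edge leaving the cycle (n ≥ 5) gives the contradiction.  When they span a triangle,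
-- φ reverses it, this reversal spreads along edges, and so G(T) is complete.

module Submission where

open import Defs
open import Algebra.Bundles using (Group)
open import Algebra.Morphism.Structures using (module GroupMorphisms)
import Algebra.Properties.Group as GroupProperties
open import Data.Empty using (⊥; ⊥-elim)
open import Data.Fin.Base using (Fin)
open import Data.Fin.Permutation using (Permutation′; transpose)
import Data.Fin.Permutation.Components as PC
open import Data.Fin.Properties using (_≟_; all?; injective⇒≤; sequence; ¬∀⟶∃¬)
open import Data.List.Base using (List; []; _∷_; length; lookup)
open import Data.List.Membership.DecPropositional using () renaming (_∈?_ to decMember)
import Data.List.Membership.Propositional as List
open import Data.List.Relation.Unary.Any using (here; there)
open import Data.List.Relation.Unary.Any.Properties using (lookup-index)
open import Data.Nat.Base using (ℕ; _≤_; _<_)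
open import Data.Nat.Properties using (<⇒≱)
open import Data.Product.Base using (∃; ∃₂; _×_; _,_; proj₁; proj₂; uncurry)
open import Data.Sum.Base as Sum using (_⊎_; inj₁; inj₂; [_,_]′)
open import Effect.Monad using (RawMonad)
open import Function.Base using (_∘_)
open import Function.Bundles using (Inverse; Equivalence; mk⇔)
import Function.Construct.Identity as Identity
open import Level using (Level; 0ℓ; _⊔_)
open import Relation.Binary.Bundles using (Setoid)
open import Relation.Binary.Construct.Closure.ReflexiveTransitive
  using (Star; _◅_; _◅◅_; reverse) renaming (ε to nil)
open import Relation.Binary.PropositionalEquality
  using (_≡_; _≢_; refl; sym; trans; cong; cong₂; subst; ≢-sym; module ≡-Reasoning)
import Relation.Binary.Reasoning.Setoid as SetoidReasoning
open import Relation.Nullary.Decidable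
  using (Dec; yes; no; map′; dec-false; decidable-stable; ¬¬-excluded-middle)
open import Relation.Nullary.Negation using (¬¬-Monad)
open import Relation.Nullary.Negation.Core using (¬_; contradiction)
open import Relation.Unary using (Pred; _∈_; _⊆_)

private
  variable
    c ℓ ℓ′ : Level

-- Automorphisms of Cayley graphs and right translations.

autGraph-isSubgroup : (G : SimpleGraph c ℓ ℓ′) → IsSubgroup (Sym (SimpleGraph.vertices G)) (AutGraph G)
autGraph-isSubgroup G = record
  { respects  = λ φ≈ψ φ-aut u v → mk⇔
      (transport (φ≈ψ u) (φ≈ψ v) ∘ Equivalence.to (φ-aut u v))
      (Equivalence.from (φ-aut u v) ∘ transport (≈-sym (φ≈ψ u)) (≈-sym (φ≈ψ v)))
  ; ε-closed  = λ _ _ → mk⇔ (λ e → e) (λ e → e)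
  ; ∙-closed  = λ {φ} {ψ} φ-aut ψ-aut u v → mk⇔
      (Equivalence.to (φ-aut (to ψ u) (to ψ v)) ∘ Equivalence.to (ψ-aut u v))
      (Equivalence.from (ψ-aut u v) ∘ Equivalence.from (φ-aut (to ψ u) (to ψ v)))
  ; ⁻¹-closed = λ {φ} φ-aut u v → mk⇔
      (Equivalence.from (φ-aut (from φ u) (from φ v))
        ∘ transport (≈-sym (strictlyInverseˡ φ u)) (≈-sym (strictlyInverseˡ φ v)))
      (transport (strictlyInverseˡ φ u) (strictlyInverseˡ φ v)
        ∘ Equivalence.to (φ-aut (from φ u) (from φ v)))
  }
  where
  open SimpleGraph G
  open Setoid vertices using () renaming (sym to ≈-sym)
  open Inverse
  transport : ∀ {u u′ v v′} → u ≈ u′ → v ≈ v′ → u ~ v → u′ ~ v′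
  transport u≈u′ v≈v′ = proj₂ respects u≈u′ ∘ proj₁ respects v≈v′

module CayleyAutomorphisms (H : Group c ℓ) (T : Pred (Group.Carrier H) ℓ′) (isConn : IsConnectionSet H T) where
  open Group H hiding (inverse) renaming (refl to ≈-refl; sym to ≈-sym; trans to ≈-trans)
  open GroupProperties H
  open IsConnectionSet isConn
  open Inverse using (to; from; to-cong; from-cong; strictlyInverseˡ; strictlyInverseʳ)
  open SetoidReasoning setoid

  private
    module SymH = Group (Sym setoid)
    module Aut = IsSubgroup (autGraph-isSubgroup (Cay H T isConn))

  translation : Carrier → Inverse setoid setoid
  translation a = record
    { to        = _∙ a
    ; from      = _∙ a ⁻¹
    ; to-cong   = ∙-congʳ
    ; from-cong = ∙-congʳ
    ; inverse   = (λ {x} y≈ → ≈-trans (∙-congʳ y≈) (//-rightDividesˡ a x))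
                , (λ {x} y≈ → ≈-trans (∙-congʳ y≈) (//-rightDividesʳ a x))
    }

  rightRegular⊆autGraph : RightRegular H ⊆ AutGraph (Cay H T isConn)
  rightRegular⊆autGraph {φ} (a , φ≈) u v = mk⇔
    (λ (t , t∈T , v≈tu) → t , t∈T , (begin
      to φ v        ≈⟨ φ≈ v ⟩
      v ∙ a         ≈⟨ ∙-congʳ v≈tu ⟩
      (t ∙ u) ∙ a   ≈⟨ assoc t u a ⟩
      t ∙ (u ∙ a)   ≈⟨ ∙-congˡ (φ≈ u) ⟨
      t ∙ to φ u    ∎))
    (λ (t , t∈T , φv≈tφu) → t , t∈T , ∙-cancelʳ a v (t ∙ u) (begin
      v ∙ a         ≈⟨ φ≈ v ⟨
      to φ v        ≈⟨ φv≈tφu ⟩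
      t ∙ to φ u    ≈⟨ ∙-congˡ (φ≈ u) ⟩
      t ∙ (u ∙ a)   ≈⟨ assoc t u a ⟨
      (t ∙ u) ∙ a   ∎))

  rightRegular-isSubgroup : IsSubgroup (Sym setoid) (RightRegular H)
  rightRegular-isSubgroup = record
    { respects  = λ φ≈ψ (a , φ≈) → a , λ b → ≈-trans (≈-sym (φ≈ψ b)) (φ≈ b)
    ; ε-closed  = ε , λ b → ≈-sym (identityʳ b)
    ; ∙-closed  = λ {φ} {ψ} (a , φ≈) (b , ψ≈) → b ∙ a , λ x →
        ≈-trans (φ≈ (to ψ x)) (≈-trans (∙-congʳ (ψ≈ x)) (assoc x b a))
    ; ⁻¹-closed = λ {φ} (a , φ≈) → a ⁻¹ , λ x → begin
        from φ x                      ≈⟨ //-rightDividesʳ a (from φ x) ⟨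
        (from φ x ∙ a) ∙ a ⁻¹         ≈⟨ ∙-congʳ (φ≈ (from φ x)) ⟨
        to φ (from φ x) ∙ a ⁻¹        ≈⟨ ∙-congʳ (strictlyInverseˡ φ x) ⟩
        x ∙ a ⁻¹                      ∎
    }

  -- Right translations act transitively on the vertices, so every automorphism is one fixing `ε`
  -- followed by a translation.
  record PointedAut : Set (c ⊔ ℓ ⊔ ℓ′) where
    no-eta-equality
    field
      perm    : Inverse setoid setoid
      isAut   : perm ∈ AutGraph (Cay H T isConn)
      fixes-ε : to perm ε ≈ ε

  open PointedAut

  infixr 20 _$_

  _$_ : PointedAut → Carrier → Carrier
  φ $ x = to (perm φ) x

  opaque
    inverse : PointedAut → PointedAut
    inverse φ = record
      { perm    = perm φ SymH.⁻¹
      ; isAut   = Aut.⁻¹-closed {perm φ} (isAut φ)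
      ; fixes-ε = ≈-trans (from-cong (perm φ) (≈-sym (fixes-ε φ))) (strictlyInverseʳ (perm φ) ε)
      }

    inverse-$ : ∀ φ x → inverse φ $ (φ $ x) ≈ x
    inverse-$ φ = strictlyInverseʳ (perm φ)

    $-inverse : ∀ φ x → φ $ (inverse φ $ x) ≈ x
    $-inverse φ = strictlyInverseˡ (perm φ)

  infixl 25 _⊙_

  opaque
    _⊙_ : PointedAut → PointedAut → PointedAut
    φ ⊙ ψ = record
      { perm    = perm φ SymH.∙ perm ψ
      ; isAut   = Aut.∙-closed {perm φ} {perm ψ} (isAut φ) (isAut ψ)
      ; fixes-ε = ≈-trans (to-cong (perm φ) (fixes-ε ψ)) (fixes-ε φ)
      }

    ⊙-$ : ∀ φ ψ x → φ ⊙ ψ $ x ≈ φ $ (ψ $ x)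
    ⊙-$ _ _ _ = ≈-refl

  -- x ↦ φ(xa) φ(a)⁻¹
  opaque
    pointAt : (φ : Inverse setoid setoid) → φ ∈ AutGraph (Cay H T isConn) → Carrier → PointedAut
    pointAt φ φ-aut a = record
      { perm    = translation (to φ a ⁻¹) SymH.∙ (φ SymH.∙ translation a)
      ; isAut   = Aut.∙-closed {translation (to φ a ⁻¹)} {φ SymH.∙ translation a}
                    (rightRegular⊆autGraph {translation (to φ a ⁻¹)} (_ , λ _ → ≈-refl))
                    (Aut.∙-closed {φ} {translation a} φ-aut
                      (rightRegular⊆autGraph {translation a} (_ , λ _ → ≈-refl)))
      ; fixes-ε = ≈-trans (∙-congʳ (to-cong φ (identityˡ a))) (inverseʳ (to φ a))
      }

    pointAt-∙ : ∀ φ φ-aut a x → to φ (x ∙ a) ≈ (pointAt φ φ-aut a $ x) ∙ to φ a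
    pointAt-∙ φ _ a x = ≈-sym (//-rightDividesˡ (to φ a) (to φ (x ∙ a)))

  -- The local behaviour of `φ` at the vertex `g`, carried back to `ε`: the equation
  -- `φ(x g) = φ(x) φ(g)` says that `shift φ g` and `φ` agree at `x`.
  shift : PointedAut → Carrier → PointedAut
  shift φ = pointAt (perm φ) (isAut φ)

  shift-∙ : ∀ φ g x → φ $ (x ∙ g) ≈ (shift φ g $ x) ∙ (φ $ g)
  shift-∙ φ = pointAt-∙ (perm φ) (isAut φ)

  $-cong : ∀ φ {x y} → x ≈ y → φ $ x ≈ φ $ y
  $-cong φ = to-cong (perm φ)

  $-injective : ∀ φ {x y} → φ $ x ≈ φ $ y → x ≈ y
  $-injective φ {x} {y} φx≈φy = ≈-trans (≈-sym (inverse-$ φ x))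
    (≈-trans ($-cong (inverse φ) φx≈φy) (inverse-$ φ y))

  $-mem : ∀ φ {t} → t ∈ T → (φ $ t) ∈ T
  $-mem φ {t} t∈T with Equivalence.to (isAut φ ε t) (t , t∈T , ≈-sym (identityʳ t))
  ... | s , s∈T , φt≈sφε = respects
    (≈-sym (≈-trans φt≈sφε (≈-trans (∙-congˡ (fixes-ε φ)) (identityʳ s)))) s∈T

  shift-congˡ : ∀ φ {g h} → g ≈ h → ∀ x → shift φ g $ x ≈ shift φ h $ x
  shift-congˡ φ {g} {h} g≈h x = ∙-cancelʳ (φ $ h) _ _ (begin
    (shift φ g $ x) ∙ (φ $ h)    ≈⟨ ∙-congˡ ($-cong φ g≈h) ⟨
    (shift φ g $ x) ∙ (φ $ g)    ≈⟨ shift-∙ φ g x ⟨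
    φ $ (x ∙ g)                  ≈⟨ $-cong φ (∙-congˡ g≈h) ⟩
    φ $ (x ∙ h)                  ≈⟨ shift-∙ φ h x ⟩
    (shift φ h $ x) ∙ (φ $ h)    ∎)

  -- Cocycle law: both sides describe `φ` at the vertex `x ∙ y`. It drives the induction over words
  -- in `T`.
  shift-shift : ∀ φ y x t → shift (shift φ y) x $ t ≈ shift φ (x ∙ y) $ t
  shift-shift φ y x t = ∙-cancelʳ (φ $ (x ∙ y)) _ _ (begin
    (shift (shift φ y) x $ t) ∙ (φ $ (x ∙ y))                   ≈⟨ ∙-congˡ (shift-∙ φ y x) ⟩
    (shift (shift φ y) x $ t) ∙ ((shift φ y $ x) ∙ (φ $ y))     ≈⟨ assoc _ _ _ ⟨
    ((shift (shift φ y) x $ t) ∙ (shift φ y $ x)) ∙ (φ $ y)     ≈⟨ ∙-congʳ (shift-∙ (shift φ y) x t) ⟨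
    (shift φ y $ (t ∙ x)) ∙ (φ $ y)                             ≈⟨ shift-∙ φ y (t ∙ x) ⟨
    φ $ ((t ∙ x) ∙ y)                                           ≈⟨ $-cong φ (assoc t x y) ⟩
    φ $ (t ∙ (x ∙ y))                                           ≈⟨ shift-∙ φ (x ∙ y) t ⟩
    (shift φ (x ∙ y) $ t) ∙ (φ $ (x ∙ y))                       ∎)

  -- From rigidity on generators to homomorphy.

  Homomorphic : PointedAut → Set (c ⊔ ℓ)
  Homomorphic φ = ∀ x y → φ $ (x ∙ y) ≈ (φ $ x) ∙ (φ $ y)

  -- Stands for `φ(t s) = φ(t) φ(s)`. Quantifying over all `φ` matters, since the induction below
  -- applies it to shifts of `φ`.
  Rigid : Set (c ⊔ ℓ ⊔ ℓ′)
  Rigid = ∀ φ {s t} → s ∈ T → t ∈ T → shift φ s $ t ≈ φ $ t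

  module _ (rigid : Rigid) where

    shift-generator : ∀ φ {t x} → t ∈ T → x ∈ ⟨_⟩ H T → shift φ x $ t ≈ φ $ t
    shift-generator φ t∈T (gen s∈T) = rigid φ s∈T t∈T
    shift-generator φ {t} t∈T unit = begin
      shift φ ε $ t                ≈⟨ identityʳ (shift φ ε $ t) ⟨
      (shift φ ε $ t) ∙ ε          ≈⟨ ∙-congˡ (fixes-ε φ) ⟨
      (shift φ ε $ t) ∙ (φ $ ε)    ≈⟨ shift-∙ φ ε t ⟨
      φ $ (t ∙ ε)                  ≈⟨ $-cong φ (identityʳ t) ⟩
      φ $ t                        ∎
    shift-generator φ {t} t∈T (mul {x} {y} x∈ y∈) = begin
      shift φ (x ∙ y) $ t          ≈⟨ shift-shift φ y x t ⟨
      shift (shift φ y) x $ t      ≈⟨ shift-generator (shift φ y) t∈T x∈ ⟩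
      shift φ y $ t                ≈⟨ shift-generator φ t∈T y∈ ⟩
      φ $ t                        ∎
    shift-generator φ {t} t∈T (inv {x} x∈) = begin
      -- Shifting further by `x` undoes the shift by `x ⁻¹`, so the hypothesis for `x` is used at
      -- `shift φ (x ⁻¹)`.
      shift φ (x ⁻¹) $ t                 ≈⟨ shift-generator (shift φ (x ⁻¹)) t∈T x∈ ⟨
      shift (shift φ (x ⁻¹)) x $ t       ≈⟨ shift-shift φ (x ⁻¹) x t ⟩
      shift φ (x ∙ x ⁻¹) $ t             ≈⟨ shift-congˡ φ (inverseʳ x) t ⟩
      shift φ ε $ t                      ≈⟨ shift-generator φ t∈T unit ⟩
      φ $ t                              ∎
    shift-generator φ {t} t∈T (resp x≈y x∈) = ≈-trans
      (shift-congˡ φ (≈-sym x≈y) t) (shift-generator φ t∈T x∈)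

    rigid⇒homomorphic : ∀ φ → Homomorphic φ
    rigid⇒homomorphic φ x = go (generates x)
      where
      go : ∀ {x} → x ∈ ⟨_⟩ H T → ∀ y → φ $ (x ∙ y) ≈ (φ $ x) ∙ (φ $ y)
      go (gen {t} t∈T) y = ≈-trans (shift-∙ φ y t) (∙-congʳ (shift-generator φ t∈T (generates y)))
      go unit y = ≈-trans ($-cong φ (identityˡ y))
        (≈-sym (≈-trans (∙-congʳ (fixes-ε φ)) (identityˡ (φ $ y))))
      go (mul {u} {v} u∈ v∈) y = begin
        φ $ ((u ∙ v) ∙ y)                 ≈⟨ $-cong φ (assoc u v y) ⟩
        φ $ (u ∙ (v ∙ y))                 ≈⟨ go u∈ (v ∙ y) ⟩
        (φ $ u) ∙ (φ $ (v ∙ y))           ≈⟨ ∙-congˡ (go v∈ y) ⟩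
        (φ $ u) ∙ ((φ $ v) ∙ (φ $ y))     ≈⟨ assoc _ _ _ ⟨
        ((φ $ u) ∙ (φ $ v)) ∙ (φ $ y)     ≈⟨ ∙-congʳ (go u∈ v) ⟨
        (φ $ (u ∙ v)) ∙ (φ $ y)           ∎
      go (inv {u} u∈) y = begin
        φ $ (u ⁻¹ ∙ y)                    ≈⟨ divide y ⟩
        (φ $ u) ⁻¹ ∙ (φ $ y)              ≈⟨ ∙-congʳ φu⁻¹ ⟨
        (φ $ (u ⁻¹)) ∙ (φ $ y)            ∎
        where
        divide : ∀ z → φ $ (u ⁻¹ ∙ z) ≈ (φ $ u) ⁻¹ ∙ (φ $ z)
        divide z = begin
          φ $ (u ⁻¹ ∙ z)                                   ≈⟨ \\-leftDividesʳ (φ $ u) _ ⟨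
          (φ $ u) ⁻¹ ∙ ((φ $ u) ∙ (φ $ (u ⁻¹ ∙ z)))        ≈⟨ ∙-congˡ (go u∈ (u ⁻¹ ∙ z)) ⟨
          (φ $ u) ⁻¹ ∙ (φ $ (u ∙ (u ⁻¹ ∙ z)))              ≈⟨ ∙-congˡ ($-cong φ (\\-leftDividesˡ u z)) ⟩
          (φ $ u) ⁻¹ ∙ (φ $ z)                             ∎
        φu⁻¹ : φ $ (u ⁻¹) ≈ (φ $ u) ⁻¹
        φu⁻¹ = begin
          φ $ (u ⁻¹)                ≈⟨ $-cong φ (identityʳ (u ⁻¹)) ⟨
          φ $ (u ⁻¹ ∙ ε)            ≈⟨ divide ε ⟩
          (φ $ u) ⁻¹ ∙ (φ $ ε)      ≈⟨ ∙-congˡ (fixes-ε φ) ⟩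
          (φ $ u) ⁻¹ ∙ ε            ≈⟨ identityʳ _ ⟩
          (φ $ u) ⁻¹                ∎
      go (resp x≈x′ x∈) y = ≈-trans ($-cong φ (∙-congʳ (≈-sym x≈x′)))
        (≈-trans (go x∈ y) (∙-congʳ ($-cong φ x≈x′)))

  -- Group automorphisms stabilising `T` and the semidirect product.

  homomorphic⇒isGroupIso : ∀ (φ : Inverse setoid setoid) →
    (∀ x y → to φ (x ∙ y) ≈ to φ x ∙ to φ y) → φ ∈ AutGroup H
  homomorphic⇒isGroupIso φ φ-∙ = record
    { isGroupMonomorphism = record
      { isGroupHomomorphism = record
        { isMonoidHomomorphism = record
          { isMagmaHomomorphism = record
            { isRelHomomorphism = record { cong = to-cong φ }
            ; homo = φ-∙
            }
          ; ε-homo = φε≈ε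
          }
        ; ⁻¹-homo = λ x → inverseˡ-unique (to φ (x ⁻¹)) (to φ x)
            (≈-trans (≈-sym (φ-∙ (x ⁻¹) x)) (≈-trans (to-cong φ (inverseˡ x)) φε≈ε))
        }
      ; injective = λ {x} {y} φx≈φy → ≈-trans (≈-sym (strictlyInverseʳ φ x))
          (≈-trans (from-cong φ φx≈φy) (strictlyInverseʳ φ y))
      }
    ; surjective = λ y → from φ y , λ z≈ → ≈-trans (to-cong φ z≈) (strictlyInverseˡ φ y)
    }
    where
    φε≈ε : to φ ε ≈ ε
    φε≈ε = identityʳ-unique (to φ ε) (to φ ε)
      (≈-trans (≈-sym (φ-∙ ε ε)) (to-cong φ (identityˡ ε)))

  private
    module Iso = GroupMorphisms.IsGroupIsomorphism

  autGroupStabilising⊆autGraph : AutGroupStabilising H T ⊆ AutGraph (Cay H T isConn)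
  autGroupStabilising⊆autGraph {φ} (φ-iso , im⊆T , T⊆im) u v = mk⇔
    (λ (t , t∈T , v≈tu) → to φ t , im⊆T (t , t∈T , ≈-refl) ,
      ≈-trans (to-cong φ v≈tu) (Iso.∙-homo φ-iso t u))
    (λ (s , s∈T , φv≈sφu) →
      let t , t∈T , s≈φt = T⊆im s∈T
      in t , t∈T , Iso.injective φ-iso
        (≈-trans φv≈sφu (≈-trans (∙-congʳ s≈φt) (≈-sym (Iso.∙-homo φ-iso t u)))))

  autGroupStabilising-isSubgroup : IsSubgroup (Sym setoid) (AutGroupStabilising H T)
  autGroupStabilising-isSubgroup = record
    { respects = λ {φ} {ψ} φ≈ψ (φ-iso , im⊆T , T⊆im) →
        homomorphic⇒isGroupIso ψ (λ x y → ≈-trans (≈-sym (φ≈ψ (x ∙ y)))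
          (≈-trans (Iso.∙-homo φ-iso x y) (∙-cong (φ≈ψ x) (φ≈ψ y))))
        , (λ (t , t∈T , y≈ψt) → im⊆T (t , t∈T , ≈-trans y≈ψt (≈-sym (φ≈ψ t))))
        , (λ y∈T → let t , t∈T , y≈φt = T⊆im y∈T in t , t∈T , ≈-trans y≈φt (φ≈ψ t))
    ; ε-closed = homomorphic⇒isGroupIso SymH.ε (λ _ _ → ≈-refl)
        , (λ (t , t∈T , y≈t) → respects (≈-sym y≈t) t∈T) , (λ y∈T → _ , y∈T , ≈-refl)
    ; ∙-closed = λ {φ} {ψ} (φ-iso , φ⊆T , T⊆φ) (ψ-iso , ψ⊆T , T⊆ψ) →
        homomorphic⇒isGroupIso (φ SymH.∙ ψ) (λ x y →
          ≈-trans (to-cong φ (Iso.∙-homo ψ-iso x y)) (Iso.∙-homo φ-iso _ _))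
        , (λ (t , t∈T , y≈) → φ⊆T (to ψ t , ψ⊆T (t , t∈T , ≈-refl) , y≈))
        , (λ y∈T → let s , s∈T , y≈φs = T⊆φ y∈T
                       t , t∈T , s≈ψt = T⊆ψ s∈T
                   in t , t∈T , ≈-trans y≈φs (to-cong φ s≈ψt))
    ; ⁻¹-closed = λ {φ} (φ-iso , φ⊆T , T⊆φ) →
        homomorphic⇒isGroupIso (φ SymH.⁻¹) (λ x y → Iso.injective φ-iso
          (≈-trans (strictlyInverseˡ φ (x ∙ y)) (≈-sym (≈-trans (Iso.∙-homo φ-iso _ _)
            (∙-cong (strictlyInverseˡ φ x) (strictlyInverseˡ φ y))))))
        , (λ (t , t∈T , y≈) →
             let s , s∈T , t≈φs = T⊆φ t∈T
             in respects (≈-sym (≈-trans y≈ (≈-trans (from-cong φ t≈φs) (strictlyInverseʳ φ s)))) s∈T)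
        , (λ {y} y∈T → to φ y , φ⊆T (y , y∈T , ≈-refl) , ≈-sym (strictlyInverseʳ φ y))
    }

  homomorphic⇒stabilising : ∀ φ → Homomorphic φ → perm φ ∈ AutGroupStabilising H T
  homomorphic⇒stabilising φ φ-∙ = homomorphic⇒isGroupIso (perm φ) φ-∙
    , (λ (t , t∈T , y≈φt) → respects (≈-sym y≈φt) ($-mem φ t∈T))
    , (λ {y} y∈T → inverse φ $ y , $-mem (inverse φ) y∈T , ≈-sym ($-inverse φ y))

  pointAt-ε : ∀ φ φ-aut x → to φ x ≈ (pointAt φ φ-aut ε $ x) ∙ to φ ε
  pointAt-ε φ φ-aut x = ≈-trans (to-cong φ (≈-sym (identityʳ x))) (pointAt-∙ φ φ-aut ε x)

  module _ (homomorphic : ∀ φ → Homomorphic φ) where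

    -- Dividing on the right by `φ(ε)` leaves an automorphism fixing `ε`, which is a homomorphism by
    -- hypothesis.
    autGraph-factorise : ∀ {φ} → φ ∈ AutGraph (Cay H T isConn) → ∃₂ λ ρ κ →
      ρ ∈ RightRegular H × κ ∈ AutGroupStabilising H T × φ SymH.≈ ρ SymH.∙ κ
    autGraph-factorise {φ} φ-aut = translation (to φ ε) , perm κ
      , (to φ ε , λ _ → ≈-refl) , homomorphic⇒stabilising κ (homomorphic κ)
      , pointAt-ε φ φ-aut
      where κ = pointAt φ φ-aut ε

    -- Conjugating ρ_a by φ = ρ κ, with κ ∈ Aut(H), gives b ↦ b ∙ (φ(ε)⁻¹ ∙ φ(a)).
    rightRegular-normal : IsNormalSubgroupOf (Sym setoid) (RightRegular H) (AutGraph (Cay H T isConn))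
    rightRegular-normal = record
      { subgroup    = rightRegular-isSubgroup
      ; ambient     = autGraph-isSubgroup (Cay H T isConn)
      ; contained   = λ {φ} → rightRegular⊆autGraph {φ}
      ; conj-closed = λ {φ} {ψ} φ-aut (a , ψ≈) →
          let κ = pointAt φ φ-aut ε
              e = to φ ε
          in e ⁻¹ ∙ to φ a , λ b → begin
            to φ (to ψ (from φ b))                      ≈⟨ to-cong φ (ψ≈ (from φ b)) ⟩
            to φ (from φ b ∙ a)                         ≈⟨ pointAt-ε φ φ-aut (from φ b ∙ a) ⟩
            (κ $ (from φ b ∙ a)) ∙ e                    ≈⟨ ∙-congʳ (homomorphic κ (from φ b) a) ⟩
            ((κ $ from φ b) ∙ (κ $ a)) ∙ e              ≈⟨ assoc _ _ _ ⟩
            (κ $ from φ b) ∙ ((κ $ a) ∙ e)              ≈⟨ ∙-congˡ (pointAt-ε φ φ-aut a) ⟨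
            (κ $ from φ b) ∙ to φ a                     ≈⟨ ∙-congʳ (//-rightDividesʳ e (κ $ from φ b)) ⟨
            (((κ $ from φ b) ∙ e) ∙ e ⁻¹) ∙ to φ a      ≈⟨ ∙-congʳ (∙-congʳ (pointAt-ε φ φ-aut (from φ b))) ⟨
            (to φ (from φ b) ∙ e ⁻¹) ∙ to φ a           ≈⟨ ∙-congʳ (∙-congʳ (strictlyInverseˡ φ b)) ⟩
            (b ∙ e ⁻¹) ∙ to φ a                         ≈⟨ assoc _ _ _ ⟩
            b ∙ (e ⁻¹ ∙ to φ a)                         ∎
      }

    autGraph-semidirect : IsInternalSemidirectProduct (Sym setoid)
      (AutGraph (Cay H T isConn)) (RightRegular H) (AutGroupStabilising H T)
    autGraph-semidirect = record
      { N-normal    = rightRegular-normal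
      ; K-subgroup  = autGroupStabilising-isSubgroup
      ; K-contained = λ {φ} → autGroupStabilising⊆autGraph {φ}
      -- The translation by `a` sends `ε` to `a`, while a group automorphism fixes `ε`.
      ; trivial-∩   = λ {φ} (a , φ≈) (φ-iso , _) x → begin
          to φ x      ≈⟨ φ≈ x ⟩
          x ∙ a       ≈⟨ ∙-congˡ (≈-trans (≈-sym (identityˡ a)) (≈-trans (≈-sym (φ≈ ε)) (Iso.ε-homo φ-iso))) ⟩
          x ∙ ε       ≈⟨ identityʳ x ⟩
          x           ∎
      ; factorise   = λ {φ} → autGraph-factorise {φ}
      }

-- Transpositions and the relative position of two edges.

-- The argument runs in a group acting faithfully on Fin n rather than in
-- SymmetricGroup n itself: there _≈_ is neutral, so that the two sides of an
-- equation can be inferred from its proof.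
record TranspositionAction (H : Group 0ℓ 0ℓ) (n : ℕ) : Set where
  open Group H using (Carrier; _≈_; _∙_; ε)
  infixr 6 _·_
  infix 9 _⇆_
  field
    _·_      : Carrier → Fin n → Fin n
    ·-cong   : ∀ {x y} i → x ≈ y → x · i ≡ y · i
    ∙-·      : ∀ x y i → (x ∙ y) · i ≡ x · y · i
    ε-·      : ∀ i → ε · i ≡ i
    faithful : ∀ {x y} → (∀ i → x · i ≡ y · i) → x ≈ y
    _⇆_      : Fin n → Fin n → Carrier
    ⇆-left   : ∀ i j → i ⇆ j · i ≡ j
    ⇆-right  : ∀ i j → i ⇆ j · j ≡ i
    ⇆-other  : ∀ i j {k} → k ≢ i → k ≢ j → i ⇆ j · k ≡ k

module Transpositions {H : Group 0ℓ 0ℓ} {n : ℕ} (action : TranspositionAction H n) where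
  open Group H using (Carrier; _≈_; _∙_; ε; _⁻¹; inverseˡ; assoc; ∙-congˡ; ∙-congʳ)
    renaming (sym to ≈-sym; trans to ≈-trans)
  open GroupProperties H
  open TranspositionAction action

  private
    variable
      i j k l : Fin n
      p q s t x y : Carrier

  _≈?_ : ∀ x y → Dec (x ≈ y)
  x ≈? y = map′ faithful (λ x≈y i → ·-cong i x≈y) (all? λ i → x · i ≟ y · i)

  ·-injective : ∀ x → x · i ≡ x · j → i ≡ j
  ·-injective {i} {j} x xi≡xj = trans (sym (retract i)) (trans (cong (x ⁻¹ ·_) xi≡xj) (retract j))
    where
    retract : ∀ k → x ⁻¹ · x · k ≡ k
    retract k = trans (sym (∙-· (x ⁻¹) x k)) (trans (·-cong k (inverseˡ x)) (ε-· k))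

  IsTransp : Carrier → Set
  IsTransp t = ∃₂ λ i j → i ≢ j × t ≈ i ⇆ j

  at-left : t ≈ i ⇆ j → t · i ≡ j
  at-left {i = i} {j} t≈ = trans (·-cong i t≈) (⇆-left i j)

  at-right : t ≈ i ⇆ j → t · j ≡ i
  at-right {i = i} {j} t≈ = trans (·-cong j t≈) (⇆-right i j)

  at-other : t ≈ i ⇆ j → k ≢ i → k ≢ j → t · k ≡ k
  at-other {i = i} {j} {k} t≈ k≢i k≢j = trans (·-cong k t≈) (⇆-other i j k≢i k≢j)

  ⇆-comm : ∀ i j → i ⇆ j ≈ j ⇆ i
  ⇆-comm i j = faithful eq
    where
    eq : ∀ k → i ⇆ j · k ≡ j ⇆ i · k
    eq k with k ≟ i | k ≟ j
    ... | yes refl | _        = trans (⇆-left i j) (sym (⇆-right j i))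
    ... | no _     | yes refl = trans (⇆-right i j) (sym (⇆-left j i))
    ... | no k≢i   | no k≢j   = trans (⇆-other i j k≢i k≢j) (sym (⇆-other j i k≢j k≢i))

  flip-⇆ : t ≈ i ⇆ j → t ≈ j ⇆ i
  flip-⇆ {i = i} {j} t≈ = ≈-trans t≈ (⇆-comm i j)

  -- The usual conjugation rule for transpositions, cleared of inverses.
  conj : ∀ x i j → x ∙ i ⇆ j ≈ (x · i) ⇆ (x · j) ∙ x
  conj x i j = faithful λ k → trans (∙-· x (i ⇆ j) k) (trans (eq k) (sym (∙-· ((x · i) ⇆ (x · j)) x k)))
    where
    eq : ∀ k → x · i ⇆ j · k ≡ (x · i) ⇆ (x · j) · x · k
    eq k with k ≟ i | k ≟ j
    ... | yes refl | _        = trans (cong (x ·_) (⇆-left i j)) (sym (⇆-left _ _))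
    ... | no _     | yes refl = trans (cong (x ·_) (⇆-right i j)) (sym (⇆-right _ _))
    ... | no k≢i   | no k≢j   = trans (cong (x ·_) (⇆-other i j k≢i k≢j))
      (sym (⇆-other _ _ (k≢i ∘ ·-injective x) (k≢j ∘ ·-injective x)))

  ⇆-involutive : t ≈ i ⇆ j → t ∙ t ≈ ε
  ⇆-involutive {t} {i} {j} t≈ = faithful λ k → trans (∙-· t t k) (trans (eq k) (sym (ε-· k)))
    where
    eq : ∀ k → t · t · k ≡ k
    eq k with k ≟ i | k ≟ j
    ... | yes refl | _        = trans (cong (t ·_) (at-left t≈)) (at-right t≈)
    ... | no _     | yes refl = trans (cong (t ·_) (at-right t≈)) (at-left t≈)
    ... | no k≢i   | no k≢j   = trans (cong (t ·_) (at-other t≈ k≢i k≢j)) (at-other t≈ k≢i k≢j)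

  -- A transposition exchanges its only two moved points, so one of them and its image determine it.
  moves⇒≈ : IsTransp t → t · i ≡ j → i ≢ j → t ≈ i ⇆ j
  moves⇒≈ {t} {x} {y} (i , j , i≢j , t≈) tx≡y x≢y with x ≟ i | x ≟ j
  ... | yes refl | _ = subst (λ k → t ≈ x ⇆ k) (trans (sym (at-left t≈)) tx≡y) t≈
  ... | no _ | yes refl = subst (λ k → t ≈ x ⇆ k) (trans (sym (at-right t≈)) tx≡y) (flip-⇆ t≈)
  ... | no x≢i | no x≢j = contradiction (trans (sym (at-other t≈ x≢i x≢j)) tx≡y) x≢y

  -- Disjointness of supports, hence of edges in the case of transpositions. The pointwise form
  -- mentions no end points.
  Disj : Carrier → Carrier → Set
  Disj p q = ∀ i → p · i ≡ i ⊎ q · i ≡ i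

  abstract
    disj-sym : Disj p q → Disj q p
    disj-sym d i = Sum.swap (d i)

    disj-cong : p ≈ x → q ≈ y → Disj p q → Disj x y
    disj-cong p≈x q≈y d i = Sum.map (trans (sym (·-cong i p≈x))) (trans (sym (·-cong i q≈y))) (d i)

    fixes⇒disj : p · i ≡ i → p · j ≡ j → q ≈ i ⇆ j → Disj p q
    fixes⇒disj {i = i} {j} pi pj q≈ k with k ≟ i | k ≟ j
    ... | yes refl | _        = inj₁ pi
    ... | no _     | yes refl = inj₁ pj
    ... | no k≢i   | no k≢j   = inj₂ (at-other q≈ k≢i k≢j)

    ⇆-disj : p ≈ i ⇆ j → q ≈ k ⇆ l → k ≢ i → k ≢ j → l ≢ i → l ≢ j → Disj p q
    ⇆-disj p≈ q≈ k≢i k≢j l≢i l≢j = fixes⇒disj (at-other p≈ k≢i k≢j) (at-other p≈ l≢i l≢j) q≈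

    disj⇒fixes : Disj p q → q · i ≢ i → p · i ≡ i
    disj⇒fixes {i = i} d qi≢i with d i
    ... | inj₁ pi = pi
    ... | inj₂ qi = contradiction qi qi≢i

    disj⇒fixesˡ : i ≢ j → q ≈ i ⇆ j → Disj p q → p · i ≡ i
    disj⇒fixesˡ i≢j q≈ d = disj⇒fixes d λ qi → i≢j (trans (sym qi) (at-left q≈))

    disj⇒fixesʳ : i ≢ j → q ≈ i ⇆ j → Disj p q → p · j ≡ j
    disj⇒fixesʳ i≢j q≈ = disj⇒fixesˡ (≢-sym i≢j) (flip-⇆ q≈)

    disj⇒≉ : IsTransp p → Disj p q → ¬ p ≈ q
    disj⇒≉ (i , j , i≢j , p≈) d p≈q = i≢j (trans
      (sym (disj⇒fixesˡ i≢j (≈-trans (≈-sym p≈q) p≈) d)) (at-left p≈))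

    disj⇒comm : IsTransp q → Disj p q → p ∙ q ≈ q ∙ p
    disj⇒comm {q} {p} (i , j , i≢j , q≈) d = begin
      p ∙ q                        ≈⟨ ∙-congˡ q≈ ⟩
      p ∙ i ⇆ j                    ≈⟨ conj p i j ⟩
      (p · i) ⇆ (p · j) ∙ p        ≡⟨ cong₂ (λ a b → a ⇆ b ∙ p) (disj⇒fixesˡ i≢j q≈ d) (disj⇒fixesʳ i≢j q≈ d) ⟩
      i ⇆ j ∙ p                    ≈⟨ ∙-congʳ q≈ ⟨
      q ∙ p                        ∎
      where open SetoidReasoning (Group.setoid H)

  -- The edges `t` and `s` share exactly the vertex `i`; `j` and `k` are the free ends, and `j ⇆ k`
  -- would close the triangle.
  record Meet (t s : Carrier) (i j k : Fin n) : Set where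
    constructor meet
    field
      i≢j : i ≢ j
      i≢k : i ≢ k
      j≢k : j ≢ k
      t≈  : t ≈ i ⇆ j
      s≈  : s ≈ i ⇆ k

  open Meet public

  abstract
    meet-sym : Meet t s i j k → Meet s t i k j
    meet-sym (meet i≢j i≢k j≢k t≈ s≈) = meet i≢k i≢j (≢-sym j≢k) s≈ t≈

    meet-congʳ : s ≈ x → Meet t s i j k → Meet t x i j k
    meet-congʳ s≈x (meet i≢j i≢k j≢k t≈ s≈) = meet i≢j i≢k j≢k t≈ (≈-trans (≈-sym s≈x) s≈)

    meet-congˡ : t ≈ x → Meet t s i j k → Meet x s i j k
    meet-congˡ t≈x m = meet-sym (meet-congʳ t≈x (meet-sym m))

    meet⇒≉ : Meet t s i j k → ¬ t ≈ s
    meet⇒≉ {i = i} m t≈s = j≢k m (trans (sym (at-left (t≈ m))) (trans (·-cong i t≈s) (at-left (s≈ m))))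

    meet⇒¬disj : Meet t s i j k → ¬ Disj t s
    meet⇒¬disj {i = i} m d with d i
    ... | inj₁ ti = i≢j m (trans (sym ti) (at-left (t≈ m)))
    ... | inj₂ si = i≢k m (trans (sym si) (at-left (s≈ m)))

    meet⇒¬comm : Meet t s i j k → ¬ t ∙ s ≈ s ∙ t
    meet⇒¬comm {t} {s} {i} {j} {k} m ts≈st = j≢k m (sym (begin
      k            ≡⟨ at-other (t≈ m) (≢-sym (i≢k m)) (≢-sym (j≢k m)) ⟨
      t · k        ≡⟨ cong (t ·_) (at-left (s≈ m)) ⟨
      t · s · i    ≡⟨ ∙-· t s i ⟨
      t ∙ s · i    ≡⟨ ·-cong i ts≈st ⟩
      s ∙ t · i    ≡⟨ ∙-· s t i ⟩
      s · t · i    ≡⟨ cong (s ·_) (at-left (t≈ m)) ⟩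
      s · j        ≡⟨ at-other (s≈ m) (≢-sym (i≢j m)) (j≢k m) ⟩
      j            ∎))
      where open ≡-Reasoning

    -- Conjugating `s` by `t` gives the third side of the triangle. When that side lies in `T`, the
    -- neighbour `t ∙ s` of `s` is thus a neighbour of `t` too.
    meet-conj : Meet t s i j k → t ∙ s ≈ j ⇆ k ∙ t
    meet-conj {t} {s} {i} {j} {k} m = begin
      t ∙ s                        ≈⟨ ∙-congˡ (s≈ m) ⟩
      t ∙ i ⇆ k                    ≈⟨ conj t i k ⟩
      (t · i) ⇆ (t · k) ∙ t        ≡⟨ cong₂ (λ a b → a ⇆ b ∙ t) (at-left (t≈ m)) (at-other (t≈ m) (≢-sym (i≢k m)) (≢-sym (j≢k m))) ⟩
      j ⇆ k ∙ t                    ∎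
      where open SetoidReasoning (Group.setoid H)

    meet-conj′ : Meet t s i j k → s ∙ t ≈ j ⇆ k ∙ s
    meet-conj′ {j = j} {k} m = ≈-trans (meet-conj (meet-sym m)) (∙-congʳ (⇆-comm k j))

    -- Both sides equal `j ⇆ k`.
    braid : Meet t s i j k → s ∙ (t ∙ s) ≈ t ∙ (s ∙ t)
    braid {t} {s} {i} {j} {k} m = begin
      s ∙ (t ∙ s)        ≈⟨ assoc s t s ⟨
      (s ∙ t) ∙ s        ≈⟨ ∙-congʳ (meet-conj′ m) ⟩
      (j ⇆ k ∙ s) ∙ s    ≈⟨ assoc _ s s ⟩
      j ⇆ k ∙ (s ∙ s)    ≈⟨ ∙-congˡ (⇆-involutive (s≈ m)) ⟩
      j ⇆ k ∙ ε          ≈⟨ ∙-congˡ (⇆-involutive (t≈ m)) ⟨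
      j ⇆ k ∙ (t ∙ t)    ≈⟨ assoc _ t t ⟨
      (j ⇆ k ∙ t) ∙ t    ≈⟨ ∙-congʳ (meet-conj m) ⟨
      (t ∙ s) ∙ t        ≈⟨ assoc t s t ⟩
      t ∙ (s ∙ t)        ∎
      where open SetoidReasoning (Group.setoid H)

    -- Keeps the given names of the ends of `t`, which `position` would choose afresh.
    meets-at : t ≈ i ⇆ j → i ≢ j → IsTransp s → ¬ t ≈ s → ¬ Disj t s →
               ∃ (Meet t s i j) ⊎ ∃ (Meet t s j i)
    meets-at {t} {i} {j} {s} t≈ i≢j s-tr t≉s ¬d with s · i ≟ i | s · j ≟ j
    ... | yes si | yes sj = contradiction (disj-sym (fixes⇒disj si sj t≈)) ¬d
    ... | no si≢i | _ with s · i ≟ j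
    ...   | yes si≡j = contradiction (≈-trans t≈ (≈-sym (moves⇒≈ s-tr si≡j i≢j))) t≉s
    ...   | no si≢j  = inj₁ (_ , meet i≢j (≢-sym si≢i) (≢-sym si≢j) t≈ (moves⇒≈ s-tr refl (≢-sym si≢i)))
    meets-at {t} {i} {j} {s} t≈ i≢j s-tr t≉s ¬d | yes si | no sj≢j = inj₂
      (_ , meet (≢-sym i≢j) (≢-sym sj≢j) (λ i≡sj → i≢j (·-injective s (trans si i≡sj)))
             (flip-⇆ t≈) (moves⇒≈ s-tr refl (≢-sym sj≢j)))

  data Position (t s : Carrier) : Set where
    equal    : t ≈ s → Position t s
    disjoint : Disj t s → Position t s
    meeting  : Meet t s i j k → Position t s

  abstract
    private
      meeting′ : ∃ (Meet t s i j) ⊎ ∃ (Meet t s j i) → Position t s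
      meeting′ (inj₁ (_ , m)) = meeting m
      meeting′ (inj₂ (_ , m)) = meeting m

    position : IsTransp t → IsTransp s → Position t s
    position {t} {s} (i , j , i≢j , t≈) s-tr with t ≈? s
    ... | yes t≈s = equal t≈s
    ... | no t≉s with s · i ≟ i | s · j ≟ j
    ...   | yes si | yes sj = disjoint (disj-sym (fixes⇒disj si sj t≈))
    ...   | no si≢i | _ = meeting′ (meets-at t≈ i≢j s-tr t≉s λ d → si≢i (disj⇒fixesˡ i≢j t≈ (disj-sym d)))
    ...   | yes _ | no sj≢j = meeting′ (meets-at t≈ i≢j s-tr t≉s λ d → sj≢j (disj⇒fixesʳ i≢j t≈ (disj-sym d)))

    private
      ∙-eq : p ∙ t ≈ q ∙ s → ∀ i {a b} → t · i ≡ a → s · i ≡ b → p · a ≡ q · b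
      ∙-eq {p} {t} {q} {s} pt≈qs i ti si = trans (cong (p ·_) (sym ti))
        (trans (sym (∙-· p t i)) (trans (·-cong i pt≈qs) (trans (∙-· q s i) (cong (q ·_) si))))

      cancel : t ≈ i ⇆ j → p ≈ i ⇆ j → p ∙ t ≈ ε
      cancel t≈ p≈ = ≈-trans (∙-congˡ (≈-trans t≈ (≈-sym p≈))) (⇆-involutive p≈)

    -- The solutions of p t = q s are the common neighbours of t and s in the Cayley graph.
    disj-square : IsTransp p → IsTransp q → IsTransp t → IsTransp s → Disj t s →
                  p ∙ t ≈ q ∙ s → p ∙ t ≈ ε ⊎ p ≈ s
    disj-square {p} {q} {t} {s} p-tr q-tr (i , j , i≢j , t≈) s-tr d pt≈qs
      with ei ← ∙-eq pt≈qs i (at-left t≈) (disj⇒fixesˡ i≢j t≈ (disj-sym d))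
         | ej ← ∙-eq pt≈qs j (at-right t≈) (disj⇒fixesʳ i≢j t≈ (disj-sym d))
         | p · i ≟ i | p · j ≟ j
    ... | yes pi | yes pj = inj₂ (∙-cancelʳ t p s (≈-trans pt≈qs
          (≈-trans (∙-congʳ (≈-trans (moves⇒≈ q-tr (trans (sym ei) pj) i≢j) (≈-sym t≈))) (disj⇒comm s-tr d))))
    ... | no pi≢i | yes pj = contradiction (trans ej (at-right (moves⇒≈ q-tr (trans (sym ei) pj) i≢j))) pi≢i
    ... | yes pi | no pj≢j = contradiction (trans ei (at-right (moves⇒≈ q-tr (trans (sym ej) pi) (≢-sym i≢j)))) pj≢j
    ... | no pi≢i | no pj≢j with p · i ≟ j
    ...   | yes pi≡j = inj₁ (cancel t≈ (moves⇒≈ p-tr pi≡j i≢j))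
    ...   | no pi≢j = contradiction
            (at-other (moves⇒≈ p-tr refl (≢-sym pi≢i)) (≢-sym i≢j) (≢-sym pi≢j)) pj≢j

    -- The image of `i` under `p` decides the case. Besides `ε` only `s ∙ t` and `t ∙ s` can be
    -- common neighbours, and both need `j ⇆ k` as a generator.
    meet-square : IsTransp p → IsTransp q → Meet t s i j k → p ∙ t ≈ q ∙ s →
                  p ∙ t ≈ ε ⊎ (p ≈ s × q ≈ j ⇆ k) ⊎ (p ≈ j ⇆ k × q ≈ t)
    meet-square {p} {q} {t} {s} {i} {j} {k} p-tr q-tr m pt≈qs
      with ei ← ∙-eq pt≈qs i (at-left (t≈ m)) (at-left (s≈ m))
         | ej ← ∙-eq pt≈qs j (at-right (t≈ m)) (at-other (s≈ m) (≢-sym (i≢j m)) (j≢k m))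
         | ek ← ∙-eq pt≈qs k (at-other (t≈ m) (≢-sym (i≢k m)) (≢-sym (j≢k m))) (at-right (s≈ m))
         | p · i ≟ i | p · i ≟ j | p · i ≟ k
    ... | yes pi | _ | _ = inj₂ (inj₂ (flip-⇆ (moves⇒≈ p-tr (trans ek (at-right q≈)) (≢-sym (j≢k m)))
                                 , ≈-trans (flip-⇆ q≈) (≈-sym (t≈ m))))
      where
      q≈ : q ≈ j ⇆ i
      q≈ = moves⇒≈ q-tr (trans (sym ej) pi) (≢-sym (i≢j m))
    ... | no _ | yes pi≡j | _ = inj₁ (cancel (t≈ m) (moves⇒≈ p-tr pi≡j (i≢j m)))
    ... | no _ | no _ | yes pi≡k = inj₂ (inj₁ (≈-trans (moves⇒≈ p-tr pi≡k (i≢k m)) (≈-sym (s≈ m))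
                                      , moves⇒≈ q-tr (trans (sym ej) pi≡k) (j≢k m)))
    ... | no pi≢i | no pi≢j | no pi≢k = contradiction (trans ej (at-left (flip-⇆ q≈))) pi≢k
      where
      pj : p · j ≡ j
      pj = at-other (moves⇒≈ p-tr refl (≢-sym pi≢i)) (≢-sym (i≢j m)) (≢-sym pi≢j)
      q≈ : q ≈ k ⇆ j
      q≈ = moves⇒≈ q-tr (trans (sym ei) pj) (≢-sym (j≢k m))

-- If all of `Fin n` occurred in `xs`, sending each element to one of its positions would be an
-- injection into too few positions.
fresh : ∀ {n} (xs : List (Fin n)) → length xs < n → ∃ λ m → ¬ m List.∈ xs
fresh {n} xs |xs|<n = ¬∀⟶∃¬ n (List._∈ xs) (λ m → decMember _≟_ m xs) λ all∈xs →
  <⇒≱ |xs|<n (injective⇒≤ λ {i} {j} eq → trans (lookup-index (all∈xs i))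
    (trans (cong (lookup xs) eq) (sym (lookup-index (all∈xs j)))))

-- Disjointness and triangles under automorphisms fixing `ε`.

module LocalStructure {ℓ} {H : Group 0ℓ 0ℓ} {n : ℕ} (action : TranspositionAction H n)
  (T : Pred (Group.Carrier H) ℓ) (isConn : IsConnectionSet H T)
  (T⊆Transp : T ⊆ Transpositions.IsTransp action) where

  open Group H using (Carrier; _≈_; _∙_; ε; _⁻¹; inverseʳ; ∙-cong; ∙-congʳ)
    renaming (refl to ≈-refl; sym to ≈-sym; trans to ≈-trans)
  open GroupProperties H
  open TranspositionAction action
  open Transpositions action
  open CayleyAutomorphisms H T isConn
  open IsConnectionSet isConn
  open SetoidReasoning (Group.setoid H)

  private
    variable
      i j k i′ j′ k′ : Fin n
      p q s t u v x y : Carrier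

  infix 4 _—_

  _—_ : Fin n → Fin n → Set ℓ
  i — j = i ≢ j × i ⇆ j ∈ T

  abstract
    —-sym : i — j → j — i
    —-sym (i≢j , ij∈T) = ≢-sym i≢j , respects (⇆-comm _ _) ij∈T

    ∈⇒— : t ∈ T → t · i ≡ j → i ≢ j → i — j
    ∈⇒— t∈T ti≡j i≢j = i≢j , respects (moves⇒≈ (T⊆Transp t∈T) ti≡j i≢j) t∈T

    ∙≈ε⇒≈ : t ∈ T → s ∙ t ≈ ε → s ≈ t
    ∙≈ε⇒≈ {t} {s} t∈T st≈ε with T⊆Transp t∈T
    ... | _ , _ , _ , t≈ = ∙-cancelʳ t s t (≈-trans st≈ε (≈-sym (⇆-involutive t≈)))

    -- Both `t` and its image are involutions, and the edge from `t` back to `ε` goes to the edge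
    -- from `φ(t)` back to `ε`.
    shift-self : ∀ φ → t ∈ T → shift φ t $ t ≈ φ $ t
    shift-self {t} φ t∈T with T⊆Transp t∈T | T⊆Transp ($-mem φ t∈T)
    ... | _ , _ , _ , t≈ | _ , _ , _ , φt≈ = ∙-cancelʳ (φ $ t) (shift φ t $ t) (φ $ t) (begin
      (shift φ t $ t) ∙ (φ $ t)  ≈⟨ shift-∙ φ t t ⟨
      φ $ (t ∙ t)                ≈⟨ $-cong φ (⇆-involutive t≈) ⟩
      φ $ ε                      ≈⟨ PointedAut.fixes-ε φ ⟩
      ε                          ≈⟨ ⇆-involutive φt≈ ⟨
      (φ $ t) ∙ (φ $ t)          ∎)

    -- A common neighbour of `t` and `s` goes to a common neighbour of their images.
    square-map : ∀ φ → u ∙ t ≈ v ∙ s → (shift φ t $ u) ∙ (φ $ t) ≈ (shift φ s $ v) ∙ (φ $ s)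
    square-map {u} {t} {v} {s} φ ut≈vs = begin
      (shift φ t $ u) ∙ (φ $ t)   ≈⟨ shift-∙ φ t u ⟨
      φ $ (u ∙ t)                 ≈⟨ $-cong φ ut≈vs ⟩
      φ $ (v ∙ s)                 ≈⟨ shift-∙ φ s v ⟩
      (shift φ s $ v) ∙ (φ $ s)   ∎

    -- Only `ε` is mapped to `ε`; this discards the trivial common neighbour.
    shift-∙≈ε : ∀ φ → t ∈ T → (shift φ t $ u) ∙ (φ $ t) ≈ ε → u ≈ t
    shift-∙≈ε {t} {u} φ t∈T eq = ∙≈ε⇒≈ t∈T ($-injective φ
      (≈-trans (shift-∙ φ t u) (≈-trans eq (≈-sym (PointedAut.fixes-ε φ)))))

    -- If t, s are disjoint but their images meet, then the images have two
    -- common neighbours besides ε, while t, s have only one.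
    preserves-disj : ∀ φ → t ∈ T → s ∈ T → Disj t s → Disj (φ $ t) (φ $ s)
    preserves-disj {t} {s} φ t∈T s∈T d
      with position (T⊆Transp ($-mem φ t∈T)) (T⊆Transp ($-mem φ s∈T))
    ... | equal φt≈φs = contradiction ($-injective φ φt≈φs) (disj⇒≉ (T⊆Transp t∈T) d)
    ... | disjoint d′ = d′
    ... | meeting {i} {j} {k} m = contradiction φtφs≈φsφt (meet⇒¬comm m)
      where
      t≉s : ¬ t ≈ s
      t≉s = disj⇒≉ (T⊆Transp t∈T) d
      ψ : PointedAut
      ψ = inverse φ
      comm : s ∙ t ≈ t ∙ s
      comm = ≈-sym (disj⇒comm (T⊆Transp s∈T) d)
      -- The image of `s ∙ t` is a common neighbour of the images other than `ε`, and such exist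
      -- only if `j ⇆ k` lies in `T`.
      jk∈T : j ⇆ k ∈ T
      jk∈T with meet-square (T⊆Transp ($-mem (shift φ t) s∈T)) (T⊆Transp ($-mem (shift φ s) t∈T)) m (square-map φ comm)
      ... | inj₁ eq = contradiction (≈-sym (shift-∙≈ε φ t∈T eq)) t≉s
      ... | inj₂ (inj₁ (_ , q≈)) = respects q≈ ($-mem (shift φ s) t∈T)
      ... | inj₂ (inj₂ (p≈ , _)) = respects p≈ ($-mem (shift φ t) s∈T)
      only : p ∈ T → q ∈ T → p ∙ (φ $ t) ≈ q ∙ (φ $ s) → ¬ p ≈ φ $ t → ψ $ (p ∙ (φ $ t)) ≈ s ∙ t
      only {p} {q} p∈T q∈T eq p≉φt
        with disj-square (T⊆Transp ($-mem (shift ψ (φ $ t)) p∈T)) (T⊆Transp ($-mem (shift ψ (φ $ s)) q∈T))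
               (T⊆Transp ($-mem ψ ($-mem φ t∈T))) (T⊆Transp ($-mem ψ ($-mem φ s∈T)))
               (disj-cong (≈-sym (inverse-$ φ t)) (≈-sym (inverse-$ φ s)) d) (square-map ψ eq)
      ... | inj₁ eq′ = contradiction (shift-∙≈ε ψ ($-mem φ t∈T) eq′) p≉φt
      ... | inj₂ p′≈ = ≈-trans (shift-∙ ψ (φ $ t) p)
        (∙-cong (≈-trans p′≈ (inverse-$ φ s)) (inverse-$ φ t))
      φs≉φt : ¬ φ $ s ≈ φ $ t
      φs≉φt e = t≉s (≈-sym ($-injective φ e))
      jk≉φt : ¬ j ⇆ k ≈ φ $ t
      jk≉φt e = ≢-sym (j≢k m) (trans (sym (at-other (t≈ m) (≢-sym (i≢k m)) (≢-sym (j≢k m)))) (at-right (≈-sym e)))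
      φtφs≈φsφt : (φ $ t) ∙ (φ $ s) ≈ (φ $ s) ∙ (φ $ t)
      φtφs≈φsφt = ≈-trans (meet-conj m) ($-injective ψ (≈-trans
        (only jk∈T ($-mem φ t∈T) (≈-sym (meet-conj m)) jk≉φt)
        (≈-sym (only ($-mem φ s∈T) jk∈T (meet-conj′ m) φs≉φt))))

    reflects-disj : ∀ φ → t ∈ T → s ∈ T → Disj (φ $ t) (φ $ s) → Disj t s
    reflects-disj {t} {s} φ t∈T s∈T d = disj-cong (inverse-$ φ t) (inverse-$ φ s)
      (preserves-disj (inverse φ) ($-mem φ t∈T) ($-mem φ s∈T) d)

    preserves-meet : ∀ φ → t ∈ T → s ∈ T → Meet t s i j k → ∃ λ i′ → ∃₂ (Meet (φ $ t) (φ $ s) i′)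
    preserves-meet φ t∈T s∈T m with position (T⊆Transp ($-mem φ t∈T)) (T⊆Transp ($-mem φ s∈T))
    ... | equal φt≈φs = contradiction ($-injective φ φt≈φs) (meet⇒≉ m)
    ... | disjoint d  = contradiction (reflects-disj φ t∈T s∈T d) (meet⇒¬disj m)
    ... | meeting m′  = _ , _ , _ , m′

    reflects-meet : ∀ φ → t ∈ T → s ∈ T → Meet (φ $ t) (φ $ s) i j k → ∃ λ i′ → ∃₂ (Meet t s i′)
    reflects-meet {t} {s} φ t∈T s∈T m with preserves-meet (inverse φ) ($-mem φ t∈T) ($-mem φ s∈T) m
    ... | _ , _ , _ , m′ = _ , _ , _ , meet-congˡ (inverse-$ φ t) (meet-congʳ (inverse-$ φ s) m′)

    -- The images are again disjoint, so the common neighbour `s ∙ t` can only go to `φ(s) φ(t)`,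
    -- the sole one besides `ε`.
    shift-disj : ∀ φ → t ∈ T → s ∈ T → Disj t s → shift φ t $ s ≈ φ $ s
    shift-disj {t} {s} φ t∈T s∈T d
      with disj-square (T⊆Transp ($-mem (shift φ t) s∈T)) (T⊆Transp ($-mem (shift φ s) t∈T))
             (T⊆Transp ($-mem φ t∈T)) (T⊆Transp ($-mem φ s∈T)) (preserves-disj φ t∈T s∈T d)
             (square-map φ (≈-sym (disj⇒comm (T⊆Transp s∈T) d)))
    ... | inj₁ eq = contradiction (≈-sym (shift-∙≈ε φ t∈T eq)) (disj⇒≉ (T⊆Transp t∈T) d)
    ... | inj₂ eq = eq

    -- The third side makes `t ∙ s` a common neighbour of `t` and `s`, and its image requires a
    -- third side for the images.
    triangle : ∀ φ → t ∈ T → s ∈ T → Meet t s i j k → j — k → Meet (φ $ t) (φ $ s) i′ j′ k′ → j′ — k′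
    triangle {t} {s} {j = j} {k} {j′ = j′} {k′} φ t∈T s∈T m (_ , jk∈T) m′ = j≢k m′ , third
      where
      third : j′ ⇆ k′ ∈ T
      third with meet-square (T⊆Transp ($-mem (shift φ t) jk∈T)) (T⊆Transp ($-mem (shift φ s) t∈T)) m′
                   (square-map φ (≈-sym (meet-conj m)))
      ... | inj₁ eq = contradiction (trans (sym (at-other (t≈ m) (≢-sym (i≢k m)) (≢-sym (j≢k m))))
                        (at-right (≈-sym (shift-∙≈ε φ t∈T eq)))) (j≢k m ∘ sym)
      ... | inj₂ (inj₁ (_ , q≈)) = respects q≈ ($-mem (shift φ s) t∈T)
      ... | inj₂ (inj₂ (p≈ , _)) = respects p≈ ($-mem (shift φ t) jk∈T)

    reflects-triangle : ∀ φ → t ∈ T → s ∈ T → Meet (φ $ t) (φ $ s) i j k → j — k → Meet t s i′ j′ k′ → j′ — k′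
    reflects-triangle {t} {s} φ t∈T s∈T m jk m′ = triangle (inverse φ) ($-mem φ t∈T) ($-mem φ s∈T) m jk
      (meet-congˡ (≈-sym (inverse-$ φ t)) (meet-congʳ (≈-sym (inverse-$ φ s)) m′))

    -- The vertex `s ∙ t` goes to one of the common neighbours `φ(s) φ(t)` and
    -- `φ(t) φ(s) = (j k) φ(t)`.
    shift-triangle : ∀ φ → t ∈ T → s ∈ T → Meet (φ $ t) (φ $ s) i j k → j — k →
                     shift φ t $ s ≈ φ $ s ⊎ shift φ t $ s ≈ j ⇆ k
    shift-triangle {t} {s} φ t∈T s∈T m jk =
      let _ , _ , _ , m′ = reflects-meet φ t∈T s∈T m
          _ , r∈T = reflects-triangle φ t∈T s∈T m jk m′
      in [ (λ eq → contradiction (≈-sym (shift-∙≈ε φ t∈T eq)) (meet⇒≉ m′))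
         , Sum.map proj₁ proj₁
         ]′ (meet-square (T⊆Transp ($-mem (shift φ t) s∈T)) (T⊆Transp ($-mem (shift φ s) r∈T)) m
               (square-map φ (meet-conj′ m′)))

    -- If `φ(s t) = φ(t) φ(s)`, injectivity keeps `φ(t s)` off that value and leaves `φ(s) φ(t)`.
    shift-flip : ∀ φ → t ∈ T → s ∈ T → Meet (φ $ t) (φ $ s) i j k → j — k →
                 shift φ t $ s ≈ j ⇆ k → shift φ s $ t ≈ j ⇆ k
    shift-flip {t} {s} {j = j} {k} φ t∈T s∈T m jk flipped =
      let _ , _ , _ , m′ = reflects-meet φ t∈T s∈T m
      in [ (λ eq → contradiction ($-injective φ (begin
             φ $ (t ∙ s)                ≈⟨ shift-∙ φ s t ⟩
             (shift φ s $ t) ∙ (φ $ s)  ≈⟨ ∙-congʳ eq ⟩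
             (φ $ t) ∙ (φ $ s)          ≈⟨ meet-conj m ⟩
             j ⇆ k ∙ (φ $ t)            ≈⟨ ∙-congʳ flipped ⟨
             (shift φ t $ s) ∙ (φ $ t)  ≈⟨ shift-∙ φ t s ⟨
             φ $ (s ∙ t)                ∎)) (meet⇒¬comm m′))
         , (λ eq → ≈-trans eq (⇆-comm _ _))
         ]′ (shift-triangle φ s∈T t∈T (meet-sym m) (—-sym jk))

  -- Sends φ(s), for s ∈ T, to shift φ t (s): the change of φ on edges from ε to t.
  twist : PointedAut → Carrier → PointedAut
  twist φ t = shift φ t ⊙ inverse φ

  abstract
    twist-$ : ∀ φ → twist φ t $ (φ $ s) ≈ shift φ t $ s
    twist-$ {t} {s} φ = ≈-trans (⊙-$ (shift φ t) (inverse φ) (φ $ s)) ($-cong (shift φ t) (inverse-$ φ s))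

    twist-self : ∀ φ → t ∈ T → twist φ t $ (φ $ t) ≈ φ $ t
    twist-self φ t∈T = ≈-trans (twist-$ φ) (shift-self φ t∈T)

    twist-disj : ∀ φ → t ∈ T → s ∈ T → Disj (φ $ t) s → twist φ t $ s ≈ s
    twist-disj {t} {s} φ t∈T s∈T d = ≈-trans (⊙-$ (shift φ t) (inverse φ) s) (≈-trans
      (shift-disj φ t∈T ($-mem (inverse φ) s∈T)
        (reflects-disj φ t∈T ($-mem (inverse φ) s∈T) (disj-cong ≈-refl (≈-sym ($-inverse φ s)) d)))
      ($-inverse φ s))

    -- Connectivity of `G(T)`: a generator moves each point along at most one edge.
    walk : x ∈ ⟨_⟩ H T → ∀ i → Star _—_ i (x · i)
    walk {x} (gen x∈T) i with x · i ≟ i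
    ... | yes xi≡i = subst (Star _—_ i) (sym xi≡i) nil
    ... | no xi≢i  = ∈⇒— x∈T refl (≢-sym xi≢i) ◅ nil
    walk unit i = subst (Star _—_ i) (sym (ε-· i)) nil
    walk (mul {x} {y} x∈ y∈) i = subst (Star _—_ i) (sym (∙-· x y i)) (walk y∈ i ◅◅ walk x∈ (y · i))
    walk (inv {x} x∈) i = reverse —-sym (subst (Star _—_ (x ⁻¹ · i))
      (trans (sym (∙-· x (x ⁻¹) i)) (trans (·-cong i (inverseʳ x)) (ε-· i))) (walk x∈ (x ⁻¹ · i)))
    walk (resp x≈y x∈) i = subst (Star _—_ i) (·-cong i x≈y) (walk x∈ i)

    connected : ∀ i j → Star _—_ i j
    connected i j = subst (Star _—_ i) (⇆-left i j) (walk (generates (i ⇆ j)) i)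

    -- Follows the walk to its first vertex outside `xs`.
    leaves : ∀ xs → Star _—_ i j → i List.∈ xs → ¬ j List.∈ xs →
             ∃₂ λ u m → u List.∈ xs × ¬ m List.∈ xs × u — m
    leaves xs nil i∈ j∉ = contradiction i∈ j∉
    leaves xs (_◅_ {j = k} ik kj) i∈ j∉ with decMember _≟_ k xs
    ... | yes k∈ = leaves xs kj k∈ j∉
    ... | no k∉  = _ , k , i∈ , k∉ , ik

-- Meeting images that span no triangle.

module Rigidity {ℓ} {H : Group 0ℓ 0ℓ} {n : ℕ} (action : TranspositionAction H n)
  (T : Pred (Group.Carrier H) ℓ) (isConn : IsConnectionSet H T)
  (T⊆Transp : T ⊆ Transpositions.IsTransp action) (5≤n : 5 ≤ n) where

  open Group H using (Carrier; _≈_; _∙_; ε; identityˡ; assoc; ∙-cong; ∙-congˡ; ∙-congʳ)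
    renaming (refl to ≈-refl; sym to ≈-sym; trans to ≈-trans; reflexive to ≈-reflexive)
  open GroupProperties H using (identityʳ-unique)
  open TranspositionAction action
  open Transpositions action
  open CayleyAutomorphisms H T isConn
  open LocalStructure action T isConn T⊆Transp
  open SetoidReasoning (Group.setoid H)

  -- For G(T) = C₄ = (i, k, w, j) such a θ exists; the edge i — m leaving the 4-cycle excludes it.
  no-rotation : ∀ θ {i j k w m} → i — k → i — j → j — w → i ≢ w → k ≢ w →
    (∀ {y} → k — y → y ≡ i ⊎ y ≡ w) → i — m → m ≢ j → m ≢ k → m ≢ w →
    θ $ (i ⇆ k) ≈ i ⇆ k → θ $ (j ⇆ w) ≈ j ⇆ w → ¬ θ $ (i ⇆ j) ≈ k ⇆ w
  no-rotation θ {i} {j} {k} {w} {m} (i≢k , ik∈T) (i≢j , ij∈T) (j≢w , jw∈T) i≢w k≢w nbr-k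
    (i≢m , im∈T) m≢j m≢k m≢w θik θjw θij = meet⇒¬disj im-ij
      (reflects-disj θ im∈T ij∈T (fixes⇒disj rk rw θij))
    where
    r = θ $ (i ⇆ m)
    im-ij : Meet (i ⇆ m) (i ⇆ j) i m j
    im-ij = meet i≢m i≢j m≢j ≈-refl ≈-refl
    rw : r · w ≡ w
    rw = disj⇒fixesʳ j≢w θjw (preserves-disj θ im∈T jw∈T
      (⇆-disj ≈-refl ≈-refl (≢-sym i≢j) (≢-sym m≢j) (≢-sym i≢w) (≢-sym m≢w)))
    -- If `r` moved `k`, it would be `(i k)`, already the image of `(i k)`, or `(k w)`, which moves
    -- `w`. Fixing `k` and `w`, it is disjoint from `θ(i j)`, although `(i m)` meets `(i j)`.
    rk : r · k ≡ k
    rk with r · k ≟ k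
    ... | yes rk≡k = rk≡k
    ... | no rk≢k with nbr-k (∈⇒— ($-mem θ im∈T) refl (≢-sym rk≢k))
    ...   | inj₁ rk≡i = contradiction
      ($-injective θ (≈-trans (flip-⇆ (moves⇒≈ (T⊆Transp ($-mem θ im∈T)) rk≡i (≢-sym i≢k))) (≈-sym θik)))
      (meet⇒≉ (meet i≢m i≢k m≢k ≈-refl ≈-refl))
    ...   | inj₂ rk≡w = contradiction (·-injective r (trans rk≡w (sym rw))) k≢w

  module _ (φ : PointedAut) {t s : Carrier} (t∈T : t ∈ T) (s∈T : s ∈ T) {i j k : Fin n}
    (m : Meet (φ $ t) (φ $ s) i j k) (j≁k : ¬ j — k) (unstable : ¬ shift φ t $ s ≈ φ $ s) where

    private
      -- `θ` fixes `φ(t)` and sends `φ(s)` to `p`; `θ′` fixes `φ(s)` and sends `φ(t)` to `t′`.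
      θ θ′ : PointedAut
      θ  = twist φ t
      θ′ = twist φ s

      -- Labels along two image paths: `φ(s t) = p φ(t)` and `φ(t s) = t′ φ(s)`, continued to
      -- `φ(t s t) = t″ p φ(t)` and `φ(s t s) = s″ t′ φ(s)`.
      p t′ s″ t″ : Carrier
      p  = shift φ t $ s
      t′ = shift φ s $ t
      s″ = shift φ (t ∙ s) $ s
      t″ = shift φ (s ∙ t) $ t

      t̂∈T : φ $ t ∈ T
      t̂∈T = $-mem φ t∈T
      ŝ∈T : φ $ s ∈ T
      ŝ∈T = $-mem φ s∈T
      p∈T : p ∈ T
      p∈T = $-mem (shift φ t) s∈T
      t′∈T : t′ ∈ T
      t′∈T = $-mem (shift φ s) t∈T
      s″∈T : s″ ∈ T
      s″∈T = $-mem (shift φ (t ∙ s)) s∈T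
      t″∈T : t″ ∈ T
      t″∈T = $-mem (shift φ (s ∙ t)) t∈T

    abstract
      i—j : i — j
      i—j = ∈⇒— t̂∈T (at-left (t≈ m)) (i≢j m)

      i—k : i — k
      i—k = ∈⇒— ŝ∈T (at-left (s≈ m)) (i≢k m)

      domain-meet : ∃ λ a → ∃₂ (Meet t s a)
      domain-meet = reflects-meet φ t∈T s∈T m

      t≉s : ¬ t ≈ s
      t≉s t≈s = meet⇒≉ m ($-cong φ t≈s)

      t̂≉p : ¬ φ $ t ≈ p
      t̂≉p e = t≉s ($-injective (shift φ t) (≈-trans (shift-self φ t∈T) e))

      t̂-p-meet : ¬ Disj (φ $ t) p
      t̂-p-meet d = meet⇒¬disj m (reflects-disj θ t̂∈T ŝ∈T
        (disj-cong (≈-sym (twist-self φ t∈T)) (≈-sym (twist-$ φ)) d))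

      twist-edge : ∀ {a b} → a — b → a ≢ i → a ≢ j → b ≢ i → b ≢ j → θ $ (a ⇆ b) ≈ a ⇆ b
      twist-edge (_ , ab∈T) a≢i a≢j b≢i b≢j = twist-disj φ t∈T ab∈T (⇆-disj (t≈ m) ≈-refl a≢i a≢j b≢i b≢j)

      -- `θ` carries the pair `φ(t)`, `φ(s)` to `φ(t)`, `p`, and a triangle on the latter would give
      -- the absent edge between `j` and `k`.
      no-triangle : ∀ {a b v} → Meet (φ $ t) p a b v → ¬ b — v
      no-triangle m′ bv = j≁k (reflects-triangle θ t̂∈T ŝ∈T
        (meet-congˡ (≈-sym (twist-self φ t∈T)) (meet-congʳ (≈-sym (twist-$ φ)) m′)) bv m)

      ŝ-t′-meet : ¬ Disj (φ $ s) t′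
      ŝ-t′-meet d = meet⇒¬disj (meet-sym m) (reflects-disj θ′ ŝ∈T t̂∈T
        (disj-cong (≈-sym (twist-self φ s∈T)) (≈-sym (twist-$ φ)) d))

      ŝ≉t′ : ¬ φ $ s ≈ t′
      ŝ≉t′ e = t≉s ($-injective (shift φ s) (≈-trans (≈-sym e) (≈-sym (shift-self φ s∈T))))

      no-triangle′ : ∀ {a b v} → Meet (φ $ s) t′ a b v → ¬ b — v
      no-triangle′ m′ bv = j≁k (—-sym (reflects-triangle θ′ ŝ∈T t̂∈T
        (meet-congˡ (≈-sym (twist-self φ s∈T)) (meet-congʳ (≈-sym (twist-$ φ)) m′)) bv (meet-sym m)))

      -- Otherwise the involution `t′` cancels in `s″ t′ φ(s)`, so that `φ(s t s) = φ(s)`, forcing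
      -- `t = s`.
      s″≉t′ : ¬ s″ ≈ t′
      s″≉t′ e = t≉s (∙≈ε⇒≈ s∈T (identityʳ-unique s (t ∙ s) ($-injective φ (begin
        φ $ (s ∙ (t ∙ s))          ≈⟨ shift-∙ φ (t ∙ s) s ⟩
        s″ ∙ (φ $ (t ∙ s))         ≈⟨ ∙-cong e (shift-∙ φ s t) ⟩
        t′ ∙ (t′ ∙ (φ $ s))        ≈⟨ assoc _ _ _ ⟨
        (t′ ∙ t′) ∙ (φ $ s)        ≈⟨ ∙-congʳ (⇆-involutive (proj₂ (proj₂ (proj₂ (T⊆Transp t′∈T))))) ⟩
        ε ∙ (φ $ s)                ≈⟨ identityˡ _ ⟩
        φ $ s                      ∎))))

      braid-image : s″ ∙ (t′ ∙ (φ $ s)) ≈ t″ ∙ (p ∙ (φ $ t))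
      braid-image = let _ , _ , _ , m′ = domain-meet in begin
        s″ ∙ (t′ ∙ (φ $ s))        ≈⟨ ∙-congˡ (shift-∙ φ s t) ⟨
        s″ ∙ (φ $ (t ∙ s))         ≈⟨ shift-∙ φ (t ∙ s) s ⟨
        φ $ (s ∙ (t ∙ s))          ≈⟨ $-cong φ (braid m′) ⟩
        φ $ (t ∙ (s ∙ t))          ≈⟨ shift-∙ φ (s ∙ t) t ⟩
        t″ ∙ (φ $ (s ∙ t))         ≈⟨ ∙-congˡ (shift-∙ φ t s) ⟩
        t″ ∙ (p ∙ (φ $ t))         ∎

      -- `φ(s)` takes `k` to `i`, while `φ(t)` and `p` fix `k`.
      braid-at-k : p · k ≡ k → s″ · t′ · i ≡ t″ · k
      braid-at-k pk = trans (cong (λ a → s″ · t′ · a) (sym (at-right (s≈ m))))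
        (trans (sym (∙∙-· s″ t′ (φ $ s))) (trans (·-cong k braid-image) (trans (∙∙-· t″ p (φ $ t))
          (cong (t″ ·_) (trans (cong (p ·_) (at-other (t≈ m) (≢-sym (i≢k m)) (≢-sym (j≢k m)))) pk)))))
        where
        ∙∙-· : ∀ x y z → (x ∙ (y ∙ z)) · k ≡ x · y · z · k
        ∙∙-· x y z = trans (∙-· x (y ∙ z) k) (cong (x ·_) (∙-· y z k))

    -- The edge to which θ moves i ⇆ k, hanging off the end c of the edge φ(t) = i ⇆ j = c ⇆ d.
    record Moved (c d k′ : Fin n) : Set ℓ where
      field
        end   : c ≡ i × d ≡ j ⊎ c ≡ j × d ≡ i
        p≈    : p ≈ c ⇆ k′
        k′≢i  : k′ ≢ i
        k′≢j  : k′ ≢ j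
        k′≢k  : k′ ≢ k
        d≁k′  : ¬ d — k′

      avoid : ∀ {x} → x ≢ i → x ≢ j → x ≢ c
      avoid x≢i x≢j x≡c = [ (λ (c≡i , _) → x≢i (trans x≡c c≡i)) , (λ (c≡j , _) → x≢j (trans x≡c c≡j)) ]′ end

      k≢c : k ≢ c
      k≢c = avoid (≢-sym (i≢k m)) (≢-sym (j≢k m))

      k′≢c : k′ ≢ c
      k′≢c = avoid k′≢i k′≢j

      pk : p · k ≡ k
      pk = at-other p≈ k≢c (≢-sym k′≢k)

      c—k′ : c — k′
      c—k′ = ∈⇒— p∈T (at-left p≈) (≢-sym k′≢c)

    open Moved

    abstract
      -- `p` meets `φ(t)` at one end. If at `i`, then `k′ = k` would mean `p = φ(s)`; if at `j`,
      -- then `k′` is not adjacent to `i`, but `k` is.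
      moved : ∃ (Moved i j) ⊎ ∃ (Moved j i)
      moved = Sum.map
        (λ (k′ , m′) → k′ , record
          { end = inj₁ (refl , refl) ; p≈ = s≈ m′ ; k′≢i = ≢-sym (i≢k m′) ; k′≢j = ≢-sym (j≢k m′)
          ; k′≢k = λ k′≡k → unstable (≈-trans (s≈ m′) (≈-trans (≈-reflexive (cong (i ⇆_) k′≡k)) (≈-sym (s≈ m))))
          ; d≁k′ = no-triangle m′ })
        (λ (k′ , m′) → k′ , record
          { end = inj₂ (refl , refl) ; p≈ = s≈ m′ ; k′≢i = ≢-sym (j≢k m′) ; k′≢j = ≢-sym (i≢k m′)
          ; k′≢k = λ k′≡k → no-triangle m′ (subst (i —_) (sym k′≡k) i—k)
          ; d≁k′ = no-triangle m′ })
        (meets-at (t≈ m) (i≢j m) (T⊆Transp p∈T) t̂≉p t̂-p-meet)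

      -- Any other edge at `k` would be disjoint from `φ(t)`, hence fixed by `θ`, and disjoint from
      -- `p`, the image of `φ(s)`, although it meets `φ(s)` at `k`.
      neighbours-k : ∀ {c d k′ w} → Moved c d k′ → k — w → w ≡ i ⊎ w ≡ k′
      neighbours-k {c} {d} {k′} {w} mv kw@(k≢w , kw∈T) with w ≟ i | w ≟ k′
      ... | yes w≡i | _ = inj₁ w≡i
      ... | no _ | yes w≡k′ = inj₂ w≡k′
      ... | no w≢i | no w≢k′ = contradiction
        (reflects-disj θ kw∈T ŝ∈T (disj-cong (≈-sym (twist-edge kw (≢-sym (i≢k m)) (≢-sym (j≢k m)) w≢i w≢j))
          (≈-sym (twist-$ φ)) (⇆-disj ≈-refl (p≈ mv) (≢-sym (k≢c mv)) (≢-sym (avoid mv w≢i w≢j))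
            (k′≢k mv) (≢-sym w≢k′))))
        (meet⇒¬disj (meet k≢w (≢-sym (i≢k m)) w≢i ≈-refl (flip-⇆ (s≈ m))))
        where
        w≢j : w ≢ j
        w≢j refl = j≁k (—-sym kw)

      -- The mirror argument: another edge at `k′` would be fixed by `θ` and disjoint from `φ(s)`,
      -- but it meets `p`.
      neighbours-k′ : ∀ {c d k′ w} → Moved c d k′ → k′ — w → w ≡ c ⊎ w ≡ k
      neighbours-k′ {c} {d} {k′} {w} mv k′w@(k′≢w , k′w∈T) with w ≟ c | w ≟ k
      ... | yes w≡c | _ = inj₁ w≡c
      ... | no _ | yes w≡k = inj₂ w≡k
      ... | no w≢c | no w≢k = contradiction
        (disj-cong (twist-edge k′w (k′≢i mv) (k′≢j mv) w≢i w≢j) (twist-$ φ)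
          (preserves-disj θ k′w∈T ŝ∈T (⇆-disj ≈-refl (s≈ m) (≢-sym (k′≢i mv)) (≢-sym w≢i)
            (≢-sym (k′≢k mv)) (≢-sym w≢k))))
        (meet⇒¬disj (meet k′≢w (k′≢c mv) w≢c ≈-refl (flip-⇆ (p≈ mv))))
        where
        w≢d : w ≢ d
        w≢d refl = d≁k′ mv (—-sym k′w)
        w≢i : w ≢ i
        w≢i w≡i = [ (λ (c≡i , _) → w≢c (trans w≡i (sym c≡i))) , (λ (_ , d≡i) → w≢d (trans w≡i (sym d≡i))) ]′ (end mv)
        w≢j : w ≢ j
        w≢j w≡j = [ (λ (_ , d≡j) → w≢d (trans w≡j (sym d≡j))) , (λ (c≡j , _) → w≢c (trans w≡j (sym c≡j))) ]′ (end mv)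

      -- Comparing the two sides of the braid relation at the vertex k.
      square : ∀ {c d k′} → Moved c d k′ → c ≢ i × k — k′ × (t′ ≈ k ⇆ k′ ⊎ t″ ≈ k ⇆ k′)
      square {c} {d} {k′} mv = [ uncurry at-i , uncurry at-k ]′
        (meets-at (s≈ m) (i≢k m) (T⊆Transp t′∈T) ŝ≉t′ ŝ-t′-meet)
        where
        -- If `t′` meets `φ(s)` at `k`, the degree bound leaves `t′ = (k k′)`, and `c = i` would
        -- close a triangle on `φ(s)` and `t′`.
        at-k : ∀ w → Meet (φ $ s) t′ k i w → c ≢ i × k — k′ × (t′ ≈ k ⇆ k′ ⊎ t″ ≈ k ⇆ k′)
        at-k w m′ with neighbours-k mv (∈⇒— t′∈T (at-left (s≈ m′)) (i≢k m′))
        ... | inj₁ w≡i = contradiction (sym w≡i) (j≢k m′)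
        ... | inj₂ refl = (λ { refl → no-triangle′ m′ (c—k′ mv) })
                        , ∈⇒— t′∈T (at-left (s≈ m′)) (i≢k m′) , inj₁ (s≈ m′)
        -- If `t′ = (i v)`, the braid relation reads `s″(v) = t″(k)`. The degree bounds force this
        -- vertex to be `k′` and `v` to be `c`.
        at-i : ∀ v → Meet (φ $ s) t′ i k v → c ≢ i × k — k′ × (t′ ≈ k ⇆ k′ ⊎ t″ ≈ k ⇆ k′)
        at-i v m′ with eq ← trans (cong (s″ ·_) (sym (at-left (s≈ m′)))) (braid-at-k (pk mv))
                     | s″ · v ≟ i | s″ · v ≟ k
        ... | yes s″v≡i | _ = contradiction
              (≈-trans (flip-⇆ (moves⇒≈ (T⊆Transp s″∈T) s″v≡i (≢-sym (i≢k m′)))) (≈-sym (s≈ m′))) s″≉t′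
        ... | no _ | yes s″v≡k = contradiction (—-sym (∈⇒— s″∈T s″v≡k (≢-sym (j≢k m′)))) (no-triangle′ m′)
        ... | no s″v≢i | no s″v≢k
          with k—s″v ← ∈⇒— t″∈T (sym eq) (≢-sym s″v≢k)
          with neighbours-k mv k—s″v | v ≟ k′
        ...   | inj₁ s″v≡i | _ = contradiction s″v≡i s″v≢i
        ...   | inj₂ s″v≡k′ | yes refl = contradiction (subst (k —_) s″v≡k′ k—s″v) (no-triangle′ m′)
        ...   | inj₂ s″v≡k′ | no v≢k′ with neighbours-k′ mv (—-sym (∈⇒— s″∈T s″v≡k′ v≢k′))
        ...     | inj₁ refl = ≢-sym (i≢k m′) , subst (k —_) s″v≡k′ k—s″v
                , inj₂ (moves⇒≈ (T⊆Transp t″∈T) (trans (sym eq) s″v≡k′) (≢-sym (k′≢k mv)))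
        ...     | inj₂ v≡k = contradiction (sym v≡k) (j≢k m′)

      -- Here c = j, and i, k, k′, j form a 4-cycle whose vertices k and k′ have degree 2.
      module Square {k′ : Fin n} (mv : Moved j i k′) (k—k′ : k — k′) where
        k⇆k′-fixed : θ $ (k ⇆ k′) ≈ k ⇆ k′
        k⇆k′-fixed = twist-edge k—k′ (≢-sym (i≢k m)) (≢-sym (j≢k m)) (k′≢i mv) (k′≢j mv)

        fixes-k-k′ : ∀ {a b} → a — b → k ≢ a → k ≢ b → k′ ≢ a → k′ ≢ b →
                     (θ $ (a ⇆ b)) · k ≡ k × (θ $ (a ⇆ b)) · k′ ≡ k′
        fixes-k-k′ (_ , ab∈T) k≢a k≢b k′≢a k′≢b =
          disj⇒fixesˡ (proj₁ k—k′) k⇆k′-fixed d , disj⇒fixesʳ (proj₁ k—k′) k⇆k′-fixed d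
          where d = preserves-disj θ ab∈T (proj₂ k—k′) (⇆-disj ≈-refl ≈-refl k≢a k≢b k′≢a k′≢b)

        -- The image of `(i v)` under `θ` avoids `k` and `k′`. It meets `p = (j k′)` because `(i v)`
        -- meets `(i k)`, so it is an edge at `j`; injectivity of `θ` excludes `(i j)`.
        j-exit : ∀ {v} → i — v → v ≢ j → v ≢ k → v ≢ k′ →
                 ∃ λ w → j — w × w ≢ i × w ≢ k × w ≢ k′
        j-exit {v} iv@(i≢v , iv∈T) v≢j v≢k v≢k′ = r · j , ∈⇒— r∈T refl (≢-sym rj≢j) , rj≢i
          , (λ rj≡k → j≢k m (·-injective r (trans rj≡k (sym (proj₁ r-fixes)))))
          , (λ rj≡k′ → k′≢j mv (sym (·-injective r (trans rj≡k′ (sym (proj₂ r-fixes))))))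
          where
          r : Carrier
          r = θ $ (i ⇆ v)
          r∈T : r ∈ T
          r∈T = $-mem θ iv∈T
          r-fixes : r · k ≡ k × r · k′ ≡ k′
          r-fixes = fixes-k-k′ iv (≢-sym (i≢k m)) (≢-sym v≢k) (k′≢i mv) (≢-sym v≢k′)
          rj≢j : r · j ≢ j
          rj≢j rj≡j = meet⇒¬disj (meet i≢v (i≢k m) v≢k ≈-refl (s≈ m)) (reflects-disj θ iv∈T ŝ∈T
            (disj-cong ≈-refl (≈-sym (twist-$ φ)) (fixes⇒disj rj≡j (proj₂ r-fixes) (p≈ mv))))
          rj≢i : r · j ≢ i
          rj≢i rj≡i = meet⇒≉ (meet i≢v (i≢j m) v≢j ≈-refl (t≈ m)) ($-injective θ
            (≈-trans (flip-⇆ (moves⇒≈ (T⊆Transp r∈T) rj≡i (≢-sym (i≢j m))))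
              (≈-trans (≈-sym (t≈ m)) (≈-sym (twist-self φ t∈T)))))

        -- The image of `(j w)` under `θ` avoids `k`, `k′` and, being disjoint from `p`, also `j`;
        -- it meets `(i j)`, so it is an edge at `i`.
        i-exit : ∀ {w} → j — w → w ≢ i → w ≢ k → w ≢ k′ →
                 ∃ λ v → i — v × v ≢ j × v ≢ k × v ≢ k′
        i-exit {w} jw@(j≢w , jw∈T) w≢i w≢k w≢k′ = r · i , ∈⇒— r∈T refl (≢-sym ri≢i)
          , (λ ri≡j → i≢j m (·-injective r (trans ri≡j (sym rj≡j))))
          , (λ ri≡k → i≢k m (·-injective r (trans ri≡k (sym (proj₁ r-fixes)))))
          , (λ ri≡k′ → k′≢i mv (sym (·-injective r (trans ri≡k′ (sym (proj₂ r-fixes))))))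
          where
          r : Carrier
          r = θ $ (j ⇆ w)
          r∈T : r ∈ T
          r∈T = $-mem θ jw∈T
          r-fixes : r · k ≡ k × r · k′ ≡ k′
          r-fixes = fixes-k-k′ jw (≢-sym (j≢k m)) (≢-sym w≢k) (k′≢j mv) (≢-sym w≢k′)
          rj≡j : r · j ≡ j
          rj≡j = disj⇒fixesˡ (≢-sym (k′≢j mv)) (p≈ mv) (disj-cong ≈-refl (twist-$ φ)
            (preserves-disj θ jw∈T ŝ∈T (⇆-disj ≈-refl (s≈ m) (i≢j m) (≢-sym w≢i) (≢-sym (j≢k m)) (≢-sym w≢k))))
          ri≢i : r · i ≢ i
          ri≢i ri≡i = meet⇒¬disj (meet j≢w (≢-sym (i≢j m)) w≢i ≈-refl (flip-⇆ (t≈ m))) (reflects-disj θ jw∈T t̂∈T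
            (disj-cong ≈-refl (≈-sym (twist-self φ t∈T)) (fixes⇒disj ri≡i rj≡j (t≈ m))))

        exits : (∃ λ v → i — v × v ≢ j × v ≢ k × v ≢ k′) × (∃ λ w → j — w × w ≢ i × w ≢ k × w ≢ k′)
        -- The cycle has four vertices, so `n ≥ 5` gives a vertex `x` outside. A walk to `x` must
        -- leave the cycle at `i` or `j`, and an exit at either yields one at the other.
        exits with x , x∉ ← fresh (i ∷ j ∷ k ∷ k′ ∷ []) 5≤n
          with leaves (i ∷ j ∷ k ∷ k′ ∷ []) (connected i x) (here refl) x∉
        ... | _ , v , here refl , v∉ , iv = (v , iv , v≢) , j-exit iv (proj₁ v≢) (proj₁ (proj₂ v≢)) (proj₂ (proj₂ v≢))
          where
          v≢ : v ≢ j × v ≢ k × v ≢ k′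
          v≢ = (v∉ ∘ there ∘ here) , (v∉ ∘ there ∘ there ∘ here) , (v∉ ∘ there ∘ there ∘ there ∘ here)
        ... | _ , w , there (here refl) , w∉ , jw = i-exit jw (proj₁ w≢) (proj₁ (proj₂ w≢)) (proj₂ (proj₂ w≢)) , (w , jw , w≢)
          where
          w≢ : w ≢ i × w ≢ k × w ≢ k′
          w≢ = (w∉ ∘ here) , (w∉ ∘ there ∘ there ∘ here) , (w∉ ∘ there ∘ there ∘ there ∘ here)
        ... | _ , w , there (there (here refl)) , w∉ , kw = contradiction (neighbours-k mv kw)
              [ w∉ ∘ here , w∉ ∘ there ∘ there ∘ there ∘ here ]′
        ... | _ , w , there (there (there (here refl))) , w∉ , k′w = contradiction (neighbours-k′ mv k′w)
              [ w∉ ∘ there ∘ here , w∉ ∘ there ∘ there ∘ here ]′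

        p-ŝ-disj : Disj p (φ $ s)
        p-ŝ-disj = ⇆-disj (p≈ mv) (s≈ m) (i≢j m) (≢-sym (k′≢i mv)) (≢-sym (j≢k m)) (≢-sym (k′≢k mv))

        -- `θ′` would fix `(i k)` and `(j k′)` but move `(i j)` to the opposite edge `(k k′)` of the
        -- 4-cycle.
        t′-absurd : ¬ t′ ≈ k ⇆ k′
        t′-absurd t′≈ with (v , iv , v≢j , v≢k , v≢k′) , _ ← exits = no-rotation θ′ i—k i—j (c—k′ mv)
          (≢-sym (k′≢i mv)) (≢-sym (k′≢k mv)) (neighbours-k mv) iv v≢j v≢k v≢k′
          (≈-trans ($-cong θ′ (≈-sym (s≈ m))) (≈-trans (twist-self φ s∈T) (s≈ m)))
          (twist-disj φ s∈T (proj₂ (c—k′ mv)) (disj-cong ≈-refl (p≈ mv) (disj-sym p-ŝ-disj)))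
          (≈-trans ($-cong θ′ (≈-sym (t≈ m))) (≈-trans (twist-$ φ) t′≈))

        -- The same argument for `shift φ t` in place of `φ`: `p` replaces `φ(s)`, and `i`, `j` as
        -- well as `k`, `k′` exchange roles.
        t″-absurd : ¬ t″ ≈ k ⇆ k′
        t″-absurd t″≈ with _ , (w , jw , w≢i , w≢k , w≢k′) ← exits = no-rotation θ″ (c—k′ mv) (—-sym i—j) i—k
          (j≢k m) (k′≢k mv) (neighbours-k′ mv) jw w≢i w≢k′ w≢k
          (≈-trans ($-cong θ″ (≈-sym (p≈ mv))) (≈-trans (twist-self φ′ s∈T) (p≈ mv)))
          (twist-disj φ′ s∈T (proj₂ i—k) (disj-cong ≈-refl (s≈ m) p-ŝ-disj))
          (≈-trans ($-cong θ″ (≈-trans (≈-sym (flip-⇆ (t≈ m))) (≈-sym (shift-self φ t∈T))))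
            (≈-trans (twist-$ φ′) (≈-trans (shift-shift φ t s t) (flip-⇆ t″≈))))
          where
          φ′ θ″ : PointedAut
          φ′ = shift φ t
          θ″ = twist φ′ s

      unstable-absurd : ⊥
      unstable-absurd with moved
      ... | inj₁ (_ , mv) = proj₁ (square mv) refl
      ... | inj₂ (_ , mv) with square mv
      ...   | _ , k—k′ , inj₁ t′≈ = Square.t′-absurd mv k—k′ t′≈
      ...   | _ , k—k′ , inj₂ t″≈ = Square.t″-absurd mv k—k′ t″≈

  -- Reversed triangles and completeness of `G(T)`.

  -- Here φ(s t) = φ(t) φ(s): near ε, φ looks like inversion, which is an
  -- automorphism of the Cayley graph when G(T) is complete.
  record Flip (φ : PointedAut) (i j k : Fin n) : Set ℓ where
    field
      {t s}   : Carrier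
      t∈T     : t ∈ T
      s∈T     : s ∈ T
      meets   : Meet (φ $ t) (φ $ s) i j k
      j—k     : j — k
      flipped : shift φ t $ s ≈ j ⇆ k

    edge : i — j
    edge = ∈⇒— ($-mem φ t∈T) (at-left (t≈ meets)) (i≢j meets)

  module _ (_—?_ : ∀ i j → Dec (i — j)) where

    abstract
      unstable⇒flip : ∀ φ {t s i j k} → t ∈ T → s ∈ T → Meet (φ $ t) (φ $ s) i j k →
                      ¬ shift φ t $ s ≈ φ $ s → Flip φ i j k
      unstable⇒flip φ {j = j} {k} t∈T s∈T m unstable with j —? k
      ... | no j≁k  = ⊥-elim (unstable-absurd φ t∈T s∈T m j≁k unstable)
      ... | yes jk  = record
        { t∈T = t∈T ; s∈T = s∈T ; meets = m ; j—k = jk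
        ; flipped = [ (λ eq → contradiction eq unstable) , (λ eq → eq) ]′ (shift-triangle φ t∈T s∈T m jk)
        }

      -- `shift φ t` takes `s` to `(j k)`, so by injectivity it cannot also send the preimage of
      -- `(j k)` under `φ` there.
      flip-sym : ∀ {φ i j k} → Flip φ i j k → Flip φ j i k
      flip-sym {φ} {i} {j} {k} f = unstable⇒flip φ t∈T ($-mem (inverse φ) (proj₂ j—k))
        (meet (≢-sym (i≢j meets)) (j≢k meets) (i≢k meets) (flip-⇆ (t≈ meets)) q≈)
        λ fixed → meet⇒≉ (meet (≢-sym (i≢k meets)) (≢-sym (j≢k meets)) (i≢j meets) (flip-⇆ (s≈ meets)) (flip-⇆ q≈))
          ($-cong φ ($-injective (shift φ t) (≈-trans flipped (≈-sym (≈-trans fixed q≈)))))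
        where
        open Flip f
        q≈ : φ $ (inverse φ $ (j ⇆ k)) ≈ j ⇆ k
        q≈ = $-inverse φ (j ⇆ k)

      flip-turn : ∀ {φ i j k} → Flip φ i j k → Flip φ i k j
      flip-turn {φ} f = record
        { t∈T = s∈T ; s∈T = t∈T ; meets = meet-sym meets ; j—k = —-sym j—k
        ; flipped = ≈-trans (shift-flip φ t∈T s∈T meets j—k flipped) (⇆-comm _ _)
        }
        where open Flip f

      -- If `shift φ t` took the preimage of `(i m)` to `(i m)`, this would be disjoint from
      -- `(j k)`, its value at `s`, although `(i m)` meets `(i k)`. The resulting reversal also
      -- supplies the edge between `j` and `m`.
      flip-extend : ∀ {φ i j k m} → Flip φ i j k → i — m → m ≢ j → Flip φ i m j
      flip-extend {φ} {i} {j} {k} {m} f (i≢m , im∈T) m≢j with m ≟ k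
      ... | yes refl = flip-turn f
      ... | no m≢k = flip-turn (unstable⇒flip φ t∈T u∈T
          (meet (i≢j meets) i≢m (≢-sym m≢j) (t≈ meets) u≈) λ fixed →
            meet⇒¬disj (meet i≢m (i≢k meets) m≢k u≈ (s≈ meets))
              (preserves-disj φ u∈T s∈T (reflects-disj (shift φ t) u∈T s∈T
                (⇆-disj (≈-trans fixed u≈) flipped
                  (≢-sym (i≢j meets)) (≢-sym m≢j) (≢-sym (i≢k meets)) (≢-sym m≢k)))))
        where
        open Flip f
        u∈T : inverse φ $ (i ⇆ m) ∈ T
        u∈T = $-mem (inverse φ) im∈T
        u≈ : φ $ (inverse φ $ (i ⇆ m)) ≈ i ⇆ m
        u≈ = $-inverse φ (i ⇆ m)

      flip-everywhere : ∀ {φ i j k m} → Flip φ i j k → m ≢ i → ∃ (Flip φ i m)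
      flip-everywhere {φ} {i} {j} {k} {m} f m≢i =
        [ (λ m≡i → contradiction m≡i m≢i) , (λ g → g) ]′ (along (connected i m) (inj₁ refl))
        where
        step : ∀ {u v} → u ≡ i ⊎ ∃ (Flip φ i u) → u — v → v ≡ i ⊎ ∃ (Flip φ i v)
        step {v = v} (inj₁ refl) iv with v ≟ j
        ... | yes refl = inj₂ (k , f)
        ... | no v≢j   = inj₂ (j , flip-extend f iv v≢j)
        step {u} {v} (inj₂ (_ , g)) uv with v ≟ i
        ... | yes v≡i = inj₁ v≡i
        -- Seen from `u`, the reversal extends to the edge from `u` to `v`, and its third side joins
        -- `v` to `i`.
        ... | no v≢i  = inj₂ (u , flip-extend g
              (—-sym (Flip.j—k (flip-extend (flip-sym g) uv v≢i))) (≢-sym (proj₁ uv)))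
        along : ∀ {u v} → Star _—_ u v → u ≡ i ⊎ ∃ (Flip φ i u) → v ≡ i ⊎ ∃ (Flip φ i v)
        along nil        a = a
        along (uw ◅ wv) a = along wv (step a uw)

      -- Every vertex other than `i` is joined to `i` by a reversed edge, and the third side of the
      -- triangle on two such edges joins their other ends.
      flip⇒complete : ∀ {φ i j k} → Flip φ i j k → ∀ x y → x ≢ y → x — y
      flip⇒complete {i = i} f x y x≢y with x ≟ i | y ≟ i
      ... | yes refl | _        = Flip.edge (proj₂ (flip-everywhere f (≢-sym x≢y)))
      ... | no x≢i   | yes refl = —-sym (Flip.edge (proj₂ (flip-everywhere f x≢i)))
      ... | no x≢i   | no y≢i   = —-sym (Flip.j—k (flip-extend (proj₂ (flip-everywhere f x≢i))
            (Flip.edge (proj₂ (flip-everywhere f y≢i))) (≢-sym x≢y)))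

      incomplete⇒rigid : ¬ (∀ x y → x ≢ y → x — y) → Rigid
      incomplete⇒rigid ¬complete φ {s} {t} s∈T t∈T with (shift φ s $ t) ≈? (φ $ t)
      ... | yes eq = eq
      ... | no unstable with position (T⊆Transp ($-mem φ s∈T)) (T⊆Transp ($-mem φ t∈T))
      ...   | equal φs≈φt = contradiction
                (≈-trans (≈-trans ($-cong (shift φ s) (≈-sym ($-injective φ φs≈φt))) (shift-self φ s∈T)) φs≈φt) unstable
      ...   | disjoint d  = contradiction (shift-disj φ s∈T t∈T (reflects-disj φ s∈T t∈T d)) unstable
      ...   | meeting m   = contradiction (flip⇒complete (unstable⇒flip φ s∈T t∈T m unstable)) ¬complete

-- The symmetric group and the conclusion.

permutationAction : ∀ n → TranspositionAction (SymmetricGroup n) n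
permutationAction n = record
  { _·_      = Inverse.to
  ; ·-cong   = λ i σ≈τ → σ≈τ i
  ; ∙-·      = λ _ _ _ → refl
  ; ε-·      = λ _ → refl
  ; faithful = λ eq → eq
  ; _⇆_      = transpose
  ; ⇆-left   = transpose-moves
  ; ⇆-right  = λ i j → trans (transpose-comm i j j) (transpose-moves j i)
  ; ⇆-other  = transpose-fixes
  }
  where
  transpose-fixes : ∀ (i j : Fin n) {k} → k ≢ i → k ≢ j → PC.transpose i j k ≡ k
  transpose-fixes i j {k} k≢i k≢j rewrite dec-false (k ≟ i) k≢i | dec-false (k ≟ j) k≢j = refl

theorem1 : ∀ {ℓ} (n : ℕ) → 5 ≤ n →
    (T : Pred (Permutation′ n) ℓ) (isTr : IsTranspositionSet T)
    (gen : Generates (SymmetricGroup n) T) →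
    ¬ (transpositionGraph T isTr ≅ completeGraph n) →
    let Sₙ   = SymmetricGroup n
        conn = transpositionConnectionSet T isTr gen
    in IsInternalSemidirectProduct (Sym (Group.setoid Sₙ))
         (AutGraph (Cay Sₙ T conn)) (RightRegular Sₙ) (AutGroupStabilising Sₙ T)
       × IsNormalCayley Sₙ T conn
theorem1 n 5≤n T isTr T-generates T≇Kₙ =
  autGraph-semidirect (rigid⇒homomorphic rigid) , rightRegular-normal (rigid⇒homomorphic rigid)
  where
  open IsTranspositionSet isTr using (transpositions)
  open CayleyAutomorphisms (SymmetricGroup n) T (transpositionConnectionSet T isTr T-generates)
  open Transpositions (permutationAction n) using (_≈?_)
  open LocalStructure (permutationAction n) T (transpositionConnectionSet T isTr T-generates) transpositions using (_—_)
  open Rigidity (permutationAction n) T (transpositionConnectionSet T isTr T-generates) transpositions 5≤n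

  incomplete : ¬ (∀ i j → i ≢ j → i — j)
  incomplete complete = T≇Kₙ (Identity.inverse _ , λ i j → mk⇔ proj₁ (complete i j))

  -- Each instance of excluded middle holds under double negation, which commutes with
  -- quantification over the finite `Fin n`.
  ¬¬-decidable : ¬ ¬ (∀ i j → Dec (i — j))
  ¬¬-decidable = sequence applicative λ i → sequence applicative λ j → ¬¬-excluded-middle
    where open RawMonad ¬¬-Monad using () renaming (rawApplicative to applicative)

  -- T need not be decidable, but the conclusion of rigidity is.
  rigid : Rigid
  rigid φ {s} {t} s∈T t∈T = decidable-stable ((shift φ s $ t) ≈? (φ $ t)) λ unstable →
    ¬¬-decidable λ _—?_ → unstable (incomplete⇒rigid _—?_ incomplete φ s∈T t∈T)
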